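{- \textsc{Short Choice} is PEPP-hard: \textsc{Empty} polynomial-time reduces to \textsc{Short Choice}.
   Context: All circuits are Boolean circuits of size polynomial in $n$. A search problem $A$ polynomial-time reduces to a search problem $B$ if there are polynomial-time computable maps $f,g$ such that for every instance $I$ of $A$, $f(I)$ is an instance of $B$, and for every solution $s$ of $f(I)$, $g(I,s)$ is a solution of $I$. For a positive integer $m$, $[m]$ denotes a set of $m$ consecutive integers (encoded by $n$-bit strings). \textsc{Empty}: given a poly($n$)-size circuit $C:[2^n-2]\to[2^n-1]$, find an element $e\in[2^n-1]$ such that $C(i)\neq e$ for all $i\in[2^n-2]$. PEPP is the class of search problems polynomial-time reducible to \textsc{Empty}; a problem is PEPP-hard if \textsc{Empty} reduces to it. \textsc{Short Choice}: The universe $U$ is a set of $2^n-2$ objects, each represented by a distinct $n$-bit string. The input is a sequence of predicates $P_0,\dots,P_{n-2}$ given by poly($n$)-size circuits, with $P_i:U^{i+2}\to\{0,1\}$. A Long Choice subcertificate is a sequence of distinct elements $a_0,\dots,a_k\in U$ such that for every $i$ with $0\le i<k$ and every $j$ with $i<j\le k$, $P_i(a_0,\dots,a_i,a_j)=P_i(a_0,\dots,a_i,a_{i+1})$. An element $x\in U\setminus\{a_0,\dots,a_k\}$ extends the subcertificate if $a_0,\dots,a_k,x$ is again a Long Choice subcertificate. A solution of \textsc{Short Choice} consists of an integer $k$ with $0\le k\le n-2$, a Long Choice subcertificate $a_0,\dots,a_k$, and a bit $c\in\{0,1\}$ such that there is no $x$ extending $a_0,\dots,a_k$ with $P_k(a_0,\dots,a_k,x)=c$.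 -}

module Defs where

open import Data.Bool.Base using (Bool; true; false; not; _∧_; _∨_)
open import Data.Fin.Base using (Fin; toℕ; fromℕ<)
open import Data.List.Base using (List; []; _∷_)
open import Data.Nat.Base using (ℕ; zero; suc; _+_; _*_; _∸_; _^_; _≤_; _<_; s≤s)
open import Data.Nat.Properties using (<⇒≤)
open import Data.Product.Base using (Σ; ∃; _×_; _,_)
open import Data.Vec.Base as Vec using (Vec; []; _∷_; _∷ʳ_; head; lookup; truncate; concat)
open import Data.Vec.Membership.Propositional using (_∉_)
open import Data.Vec.Relation.Unary.All using (All)
open import Data.Vec.Relation.Unary.Unique.Propositional using (Unique)
open import Relation.Binary.PropositionalEquality.Core using (_≡_; _≢_)
open import Relation.Nullary.Negation.Core using (¬_)

-- The machine model is a variable-free WHILE language over binary trees.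

infixr 5 _∙_

data Tree : Set where
  nil : Tree
  _∙_ : Tree → Tree → Tree

size : Tree → ℕ
size nil     = 1
size (s ∙ t) = suc (size s + size t)

left right : Tree → Tree
left  nil     = nil
left  (s ∙ t) = s
right nil     = nil
right (s ∙ t) = t

infixl 4 _⨾_

data Program : Set where
  `id `nil `left `right : Program
  _⨾_                   : Program → Program → Program
  ⟨_,_⟩                 : Program → Program → Program
  `if_then_else_        : Program → Program → Program → Program
  `while_loop_          : Program → Program → Program

-- p ⊢ x ⇓ y [ c ]: on input x, p halts with output y at cost c.  Tests count
-- nil as false.  A primitive is charged the size of its input, not a unit:
-- the cost of a run then bounds the size of every tree occurring in it, so
-- repeated duplication cannot build exponentially large trees cheaply, and
-- cost agrees with Turing machine time up to a polynomial.

infix 3 _⊢_⇓_[_]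

data _⊢_⇓_[_] : Program → Tree → Tree → ℕ → Set where

  id⇓    : ∀ {x} → `id    ⊢ x ⇓ x       [ size x ]
  nil⇓   : ∀ {x} → `nil   ⊢ x ⇓ nil     [ size x ]
  left⇓  : ∀ {x} → `left  ⊢ x ⇓ left x  [ size x ]
  right⇓ : ∀ {x} → `right ⊢ x ⇓ right x [ size x ]

  seq⇓   : ∀ {p q x y z c d} →
           p ⊢ x ⇓ y [ c ] → q ⊢ y ⇓ z [ d ] →
           p ⨾ q ⊢ x ⇓ z [ c + d ]

  pair⇓  : ∀ {p q x y z c d} →
           p ⊢ x ⇓ y [ c ] → q ⊢ x ⇓ z [ d ] →
           ⟨ p , q ⟩ ⊢ x ⇓ y ∙ z [ suc (c + d) ]

  then⇓  : ∀ {b p q x s t y c d} →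
           b ⊢ x ⇓ s ∙ t [ c ] → p ⊢ x ⇓ y [ d ] →
           `if b then p else q ⊢ x ⇓ y [ c + d ]

  else⇓  : ∀ {b p q x y c d} →
           b ⊢ x ⇓ nil [ c ] → q ⊢ x ⇓ y [ d ] →
           `if b then p else q ⊢ x ⇓ y [ c + d ]

  stop⇓  : ∀ {b p x c} →
           b ⊢ x ⇓ nil [ c ] →
           `while b loop p ⊢ x ⇓ x [ c + size x ]

  loop⇓  : ∀ {b p x s t y z c d e} →
           b ⊢ x ⇓ s ∙ t [ c ] → p ⊢ x ⇓ y [ d ] → `while b loop p ⊢ y ⇓ z [ e ] →
           `while b loop p ⊢ x ⇓ z [ c + d + e ]

-- Coefficient lists, constant term first.

Polynomial : Set
Polynomial = List ℕ

⟦_⟧ : Polynomial → ℕ → ℕ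
⟦ []     ⟧ x = 0
⟦ a ∷ as ⟧ x = a + x * ⟦ as ⟧ x

-- One program computes input a ↦ output a for all a : A, in time polynomial
-- in the size of the input tree.

PolyTime : {A : Set} (input output : A → Tree) → Set
PolyTime {A} input output =
  Σ Program λ p → Σ Polynomial λ t → ∀ (a : A) →
  ∃ λ c → (p ⊢ input a ⇓ output a [ c ]) × c ≤ ⟦ t ⟧ (size (input a))

record SearchProblem : Set₁ where
  field
    Instance       : Set
    Solution       : Instance → Set
    encodeInstance : Instance → Tree
    encodeSolution : ∀ {I} → Solution I → Tree

record Reduction (A B : SearchProblem) : Set where
  private
    module A = SearchProblem A
    module B = SearchProblem B
  field
    f : A.Instance → B.Instance
    g : ∀ I → B.Solution (f I) → A.Solution I
    f-polyTime : PolyTime A.encodeInstance (λ I → B.encodeInstance (f I))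
    g-polyTime : PolyTime
      {Σ A.Instance λ I → B.Solution (f I)}
      (λ (I , s) → A.encodeInstance I ∙ B.encodeSolution s)
      (λ (I , s) → A.encodeSolution (g I s))

-- A problem about poly(n)-size circuits is a family indexed by the polynomial
-- bounding the circuit size.

CircuitProblem : Set₁
CircuitProblem = Polynomial → SearchProblem

infix 4 _≤ᴾ_

_≤ᴾ_ : CircuitProblem → CircuitProblem → Set
A ≤ᴾ B = ∀ p → ∃ λ q → Reduction (A p) (B q)

data Gate (w : ℕ) : Set where
  const   : Bool → Gate w
  neg     : Fin w → Gate w
  and or  : Fin w → Fin w → Gate w

-- Gates m w is a straight-line program starting from m wires and ending with w.
-- Every gate puts its output in front, so wires are de Bruijn indices.

infixr 5 _∷_

data Gates : ℕ → ℕ → Set where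
  []  : ∀ {m} → Gates m m
  _∷_ : ∀ {m w} → Gate m → Gates (suc m) w → Gates m w

record Circuit (m n : ℕ) : Set where
  field
    {wires} : ℕ
    gates   : Gates m wires
    outputs : Vec (Fin wires) n

open Circuit public

#gates : ∀ {m w} → Gates m w → ℕ
#gates []       = 0
#gates (g ∷ gs) = suc (#gates gs)

circuitSize : ∀ {m n} → Circuit m n → ℕ
circuitSize C = #gates (gates C)

evalGate : ∀ {w} → Gate w → Vec Bool w → Bool
evalGate (const b) ρ = b
evalGate (neg i)   ρ = not (lookup ρ i)
evalGate (and i j) ρ = lookup ρ i ∧ lookup ρ j
evalGate (or i j)  ρ = lookup ρ i ∨ lookup ρ j

evalGates : ∀ {m w} → Gates m w → Vec Bool m → Vec Bool w
evalGates []       ρ = ρ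
evalGates (g ∷ gs) ρ = evalGates gs (evalGate g ρ ∷ ρ)

eval : ∀ {m n} → Circuit m n → Vec Bool m → Vec Bool n
eval C ρ = Vec.map (lookup (evalGates (gates C) ρ)) (outputs C)

-- Numbers are encoded in unary, so that n is at most the input length.

encodeℕ : ℕ → Tree
encodeℕ zero    = nil
encodeℕ (suc n) = nil ∙ encodeℕ n

encodeFin : ∀ {n} → Fin n → Tree
encodeFin i = encodeℕ (toℕ i)

encodeBool : Bool → Tree
encodeBool false = nil
encodeBool true  = nil ∙ nil

encodeVec : ∀ {A : Set} {n} → (A → Tree) → Vec A n → Tree
encodeVec enc []       = nil
encodeVec enc (x ∷ xs) = enc x ∙ encodeVec enc xs

encodeGate : ∀ {w} → Gate w → Tree
encodeGate (const b) = encodeℕ 0 ∙ encodeBool b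
encodeGate (neg i)   = encodeℕ 1 ∙ encodeFin i
encodeGate (and i j) = encodeℕ 2 ∙ encodeFin i ∙ encodeFin j
encodeGate (or i j)  = encodeℕ 3 ∙ encodeFin i ∙ encodeFin j

encodeGates : ∀ {m w} → Gates m w → Tree
encodeGates []       = nil
encodeGates (g ∷ gs) = encodeGate g ∙ encodeGates gs

encodeCircuit : ∀ {m n} → Circuit m n → Tree
encodeCircuit C = encodeGates (gates C) ∙ encodeVec encodeFin (outputs C)

Word : ℕ → Set
Word n = Vec Bool n

encodeWord : ∀ {n} → Word n → Tree
encodeWord = encodeVec encodeBool

bit : Bool → ℕ
bit false = 0
bit true  = 1

-- Least significant bit first.

value : ∀ {n} → Word n → ℕ
value []       = 0
value (b ∷ bs) = bit b + 2 * value bs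

-- The integers are 0, …, m - 1.

infix 4 _∈[_]

_∈[_] : ∀ {n} → Word n → ℕ → Set
x ∈[ m ] = value x < m

module _ (p : Polynomial) where

  record EmptyInstance : Set where
    field
      n       : ℕ
      2≤n     : 2 ≤ n
      C       : Circuit n n
      C-size  : circuitSize C ≤ ⟦ p ⟧ n
      C-range : ∀ x → x ∈[ 2 ^ n ∸ 2 ] → eval C x ∈[ 2 ^ n ∸ 1 ]

  record EmptySolution (I : EmptyInstance) : Set where
    open EmptyInstance I
    field
      e     : Word n
      e∈    : e ∈[ 2 ^ n ∸ 1 ]
      empty : ∀ x → x ∈[ 2 ^ n ∸ 2 ] → eval C x ≢ e

Empty : CircuitProblem
Empty p = record
  { Instance       = EmptyInstance p
  ; Solution       = EmptySolution p
  ; encodeInstance = λ I → let open EmptyInstance I in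
                     encodeℕ n ∙ encodeCircuit C
  ; encodeSolution = λ s → encodeWord (EmptySolution.e s)
  }

U : ∀ {n} → Word n → Set
U {n} x = x ∈[ 2 ^ n ∸ 2 ]

Predicates : ℕ → Set
Predicates n = (i : Fin (n ∸ 1)) → Circuit ((2 + toℕ i) * n) 1

module _ {n : ℕ} (P : Predicates n) where

  -- holds i (a₀, …, aᵢ) x is Pᵢ(a₀, …, aᵢ, x).
  holds : (i : Fin (n ∸ 1)) → Vec (Word n) (suc (toℕ i)) → Word n → Bool
  holds i as x = head (eval (P i) (concat (as ∷ʳ x)))

  -- Only used for k ≤ n - 1, so that every i < k is the index of a predicate.
  record Subcertificate {k} (a : Vec (Word n) (suc k)) : Set where
    field
      inU        : All U a
      distinct   : Unique a
      consistent : ∀ (i : Fin (n ∸ 1)) (i<k : toℕ i < k) →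
                   let prefix = truncate (s≤s (<⇒≤ i<k)) a
                       next   = lookup a (fromℕ< (s≤s i<k))
                   in ∀ (j : Fin (suc k)) → toℕ i < toℕ j →
                      holds i prefix (lookup a j) ≡ holds i prefix next

  record _Extends_ {k} (x : Word n) (a : Vec (Word n) (suc k)) : Set where
    field
      inU            : U x
      fresh          : x ∉ a
      subcertificate : Subcertificate (a ∷ʳ x)

module _ (p : Polynomial) where

  record ShortChoiceInstance : Set where
    field
      n      : ℕ
      2≤n    : 2 ≤ n
      P      : Predicates n
      P-size : ∀ i → circuitSize (P i) ≤ ⟦ p ⟧ n

  record ShortChoiceSolution (I : ShortChoiceInstance) : Set where
    open ShortChoiceInstance I
    field
      k              : Fin (n ∸ 1)
      a              : Vec (Word n) (suc (toℕ k))
      subcertificate : Subcertificate P a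
      c              : Bool
      noExtension    : ¬ ∃ λ x → _Extends_ P x a × holds P k a x ≡ c

ShortChoice : CircuitProblem
ShortChoice p = record
  { Instance       = ShortChoiceInstance p
  ; Solution       = ShortChoiceSolution p
  ; encodeInstance = λ I → let open ShortChoiceInstance I in
                     encodeℕ n ∙ encodeVec (λ t → t) (Vec.tabulate λ i → encodeCircuit (P i))
  ; encodeSolution = λ s → let open ShortChoiceSolution s in
                     encodeFin k ∙ encodeVec encodeWord a ∙ encodeBool c
  }

PEPP-hard : CircuitProblem → Set
PEPP-hard B = Empty ≤ᴾ B

{-# OPTIONS --safe #-}
module Submission where

-- Let select t v w be v if all bits of w above t are 1, and w otherwise.  Put
-- C₀ = C, vₜ = Cₜ(aₜ) and Cₜ₊₁(x) = select t vₜ (Cₜ(x)), and let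
-- Pᵢ(a₀, …, aᵢ, x) be bit i of Cᵢ₊₁(x).  Call a word live at t if its bits from
-- t on are not all 1.  Every e′ live at t + 1 has a preimage e ≠ vₜ under
-- select t vₜ that is live at t: take e′ itself unless e′ = vₜ, and otherwise
-- keep the bits of e′ below t, followed by 0 at t and 1 above.  From a solution
-- (k, a, c) of Short Choice, start with bits 0, …, k - 1 of vₖ, then c, then
-- zeros, of which there is at least one since k ≤ n - 2, and take preimages
-- eₖ, …, e₀.  If C(x) = e₀, then Cₜ(x) = eₜ for all t; hence x ≠ aₜ because
-- eₜ ≠ vₜ, and x extends a with Pₖ(a, x) = c, a contradiction.  So C misses e₀,
-- which is in range, being live at 0.
--
-- As Pᵢ needs every aⱼ only through C(aⱼ), level by level, it has a circuit made
-- of equally long blocks, and g finds the vₜ by evaluating such circuits.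

open import Defs
open import Data.Bool.Base using (Bool; true; false; if_then_else_; not; _∧_; _∨_)
import Data.Bool.ListAction as ListAction
open import Data.Bool.Properties using (∧-zeroʳ; ∨-idem; ∨-identityʳ)
open import Data.Empty using (⊥-elim)
open import Data.Fin.Base as Fin using (Fin; toℕ; fromℕ<)
open import Data.Fin.Properties using (toℕ<n; toℕ-fromℕ<)
open import Data.List.Base as List using (List; []; _∷_; _++_; applyUpTo; concat; length; upTo)
open import Data.List.Properties using (applyUpTo-∷ʳ; length-++; map-applyUpTo; ++-assoc; ++-identityʳ)
open import Data.Nat.Base
open import Data.Nat.Properties
open import Data.Nat.Tactic.RingSolver using (solve-∀)
open import Data.Product.Base using (Σ; ∃; _×_; _,_; proj₁; proj₂)
open import Data.Sum.Base using (_⊎_; inj₁; inj₂)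
open import Data.Unit.Base using (⊤; tt)
open import Data.Vec.Base as Vec using (Vec; []; _∷_; _∷ʳ_; lookup; toList; truncate)
open import Data.Vec.Membership.Propositional using (_∈_; _∉_)
open import Data.Vec.Properties using (length-toList; toList-++)
open import Data.Vec.Relation.Unary.All using (All; []; _∷_)
open import Data.Vec.Relation.Unary.AllPairs using ([]; _∷_)
open import Data.Vec.Relation.Unary.Any using (here; there)
open import Data.Vec.Relation.Unary.Unique.Propositional using (Unique)
open import Function.Base using (_∘_; id)
open import Relation.Binary.PropositionalEquality
open import Relation.Nullary.Negation.Core using (¬_)

-- Polynomial-time functions on trees

-- The shape of `select` comes from a count. With bits 0, ..., t - 1 fixed, 2^(n-t) - 1 words are
-- live at t. Discarding vₜ leaves at least 2^(n-t) - 2 of them, which is twice 2^(n-t-1) - 1, the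
-- number of words live at t + 1 for each value of bit t. The one misfit is the word with 0 at t and
-- only 1 above: it is live at t but not at t + 1, and it is moved to the place that vₜ vacates.
-- After the last bit, 2^(n-k-1) - 1 words are left, which is positive exactly because k ≤ n - 2.
-- Unfolding the definition of Cₜ literally would double the circuit at each level, as Cₜ₊₁ needs Cₜ
-- twice. Computing all Cₜ(aⱼ) with j ≥ t from those of the level before takes only quadratically
-- many blocks. Wires are de Bruijn indices, so an address depends on everything pushed since;
-- blocks of equal length turn each address into a short arithmetic expression, which a program can
-- print.

IsPolynomial : (ℕ → ℕ) → Set
IsPolynomial h = Σ Polynomial λ p → ∀ x → ⟦ p ⟧ x ≡ h x

private
  _⊕_ _⊗_ _⊙_ : Polynomial → Polynomial → Polynomial
  []      ⊕ q       = q
  (a ∷ p) ⊕ []      = a ∷ p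
  (a ∷ p) ⊕ (b ∷ q) = (a + b) ∷ (p ⊕ q)

  scale : ℕ → Polynomial → Polynomial
  scale a []      = []
  scale a (b ∷ q) = a * b ∷ scale a q

  []      ⊗ q = []
  (a ∷ p) ⊗ q = scale a q ⊕ (0 ∷ (p ⊗ q))

  []      ⊙ q = []
  (a ∷ p) ⊙ q = (a ∷ []) ⊕ (q ⊗ (p ⊙ q))

  ⟦⊕⟧ : ∀ p q x → ⟦ p ⊕ q ⟧ x ≡ ⟦ p ⟧ x + ⟦ q ⟧ x
  ⟦⊕⟧ []      q       x = refl
  ⟦⊕⟧ (a ∷ p) []      x = sym (+-identityʳ _)
  ⟦⊕⟧ (a ∷ p) (b ∷ q) x rewrite ⟦⊕⟧ p q x = lemma a b x (⟦ p ⟧ x) (⟦ q ⟧ x)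
    where
    lemma : ∀ a b x s t → a + b + x * (s + t) ≡ a + x * s + (b + x * t)
    lemma = solve-∀

  ⟦scale⟧ : ∀ a q x → ⟦ scale a q ⟧ x ≡ a * ⟦ q ⟧ x
  ⟦scale⟧ a []      x = sym (*-zeroʳ a)
  ⟦scale⟧ a (b ∷ q) x rewrite ⟦scale⟧ a q x = lemma a b x (⟦ q ⟧ x)
    where
    lemma : ∀ a b x t → a * b + x * (a * t) ≡ a * (b + x * t)
    lemma = solve-∀

  ⟦⊗⟧ : ∀ p q x → ⟦ p ⊗ q ⟧ x ≡ ⟦ p ⟧ x * ⟦ q ⟧ x
  ⟦⊗⟧ []      q x = refl
  ⟦⊗⟧ (a ∷ p) q x
    rewrite ⟦⊕⟧ (scale a q) (0 ∷ (p ⊗ q)) x | ⟦scale⟧ a q x | ⟦⊗⟧ p q x =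
    lemma a x (⟦ p ⟧ x) (⟦ q ⟧ x)
    where
    lemma : ∀ a x s t → a * t + x * (s * t) ≡ (a + x * s) * t
    lemma = solve-∀

  ⟦⊙⟧ : ∀ p q x → ⟦ p ⊙ q ⟧ x ≡ ⟦ p ⟧ (⟦ q ⟧ x)
  ⟦⊙⟧ []      q x = refl
  ⟦⊙⟧ (a ∷ p) q x
    rewrite ⟦⊕⟧ (a ∷ []) (q ⊗ (p ⊙ q)) x | ⟦⊗⟧ q (p ⊙ q) x | ⟦⊙⟧ p q x | *-zeroʳ x | +-identityʳ a = refl

infixl 6 _+ᴾ_
infixl 7 _*ᴾ_
infixr 9 _∘ᴾ_

_+ᴾ_ : ∀ {h k} → IsPolynomial h → IsPolynomial k → IsPolynomial (λ x → h x + k x)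
(p , p≡) +ᴾ (q , q≡) = p ⊕ q , λ x → trans (⟦⊕⟧ p q x) (cong₂ _+_ (p≡ x) (q≡ x))

_*ᴾ_ : ∀ {h k} → IsPolynomial h → IsPolynomial k → IsPolynomial (λ x → h x * k x)
(p , p≡) *ᴾ (q , q≡) = p ⊗ q , λ x → trans (⟦⊗⟧ p q x) (cong₂ _*_ (p≡ x) (q≡ x))

_∘ᴾ_ : ∀ {h k} → IsPolynomial h → IsPolynomial k → IsPolynomial (λ x → h (k x))
_∘ᴾ_ {h} (p , p≡) (q , q≡) = p ⊙ q , λ x → trans (⟦⊙⟧ p q x) (trans (p≡ _) (cong h (q≡ x)))

constᴾ : ∀ a → IsPolynomial (λ _ → a)
constᴾ a = a ∷ [] , λ x → trans (cong (a +_) (*-zeroʳ x)) (+-identityʳ a)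

idᴾ : IsPolynomial id
idᴾ = 0 ∷ 1 ∷ [] , λ x → trans (cong (λ y → x * (1 + y)) (*-zeroʳ x)) (*-identityʳ x)

⟦_⟧ᴾ : ∀ p → IsPolynomial ⟦ p ⟧
⟦ p ⟧ᴾ = p , λ _ → refl

monotone : ∀ {h} → IsPolynomial h → ∀ {x y} → x ≤ y → h x ≤ h y
monotone (p , p≡) {x} {y} x≤y = subst₂ _≤_ (p≡ x) (p≡ y) (mono p)
  where
  mono : ∀ p → ⟦ p ⟧ x ≤ ⟦ p ⟧ y
  mono []      = z≤n
  mono (a ∷ p) = +-monoʳ-≤ a (*-mono-≤ x≤y (mono p))

size>0 : ∀ x → 1 ≤ size x
size>0 nil     = s≤s z≤n
size>0 (x ∙ y) = s≤s z≤n

size-left : ∀ x → size (left x) ≤ size x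
size-left nil     = ≤-refl
size-left (x ∙ y) = m≤n⇒m≤1+n (m≤m+n _ _)

size-right : ∀ x → size (right x) ≤ size x
size-right nil     = ≤-refl
size-right (x ∙ y) = m≤n⇒m≤1+n (m≤n+m _ _)

-- Every primitive is charged the size of its input, so cost dominates output size. This closes
-- polynomial time under composition: the second bound is taken at the value of the first.
size-output : ∀ {p x y c} → p ⊢ x ⇓ y [ c ] → size y ≤ c
size-output id⇓           = ≤-refl
size-output {x = x} nil⇓  = size>0 x
size-output {x = x} left⇓ = size-left x
size-output {x = x} right⇓ = size-right x
size-output (seq⇓ _ d)    = ≤-trans (size-output d) (m≤n+m _ _)
size-output (pair⇓ d e)   = s≤s (+-mono-≤ (size-output d) (size-output e))
size-output (then⇓ _ d)   = ≤-trans (size-output d) (m≤n+m _ _)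
size-output (else⇓ _ d)   = ≤-trans (size-output d) (m≤n+m _ _)
size-output (stop⇓ _)     = m≤n+m _ _
size-output (loop⇓ _ _ d) = ≤-trans (size-output d) (m≤n+m _ _)

record Poly (F : Tree → Tree) : Set where
  constructor poly
  field
    program : Program
    {time}  : ℕ → ℕ
    isPoly  : IsPolynomial time
    run     : ∀ x → ∃ λ c → (program ⊢ x ⇓ F x [ c ]) × c ≤ time (size x)

open Poly

size-Poly : ∀ {F} (π : Poly F) x → size (F x) ≤ time π (size x)
size-Poly π x = let _ , d , c≤ = run π x in ≤-trans (size-output d) c≤

ext : ∀ {F G} → (∀ x → F x ≡ G x) → Poly F → Poly G
ext F≗G (poly p t r) = poly p t λ x →
  let c , d , c≤ = r x in c , subst (λ y → p ⊢ x ⇓ y [ c ]) (F≗G x) d , c≤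

polyTime : ∀ {F} {A : Set} {input output : A → Tree} → Poly F →
           (∀ a → F (input a) ≡ output a) → PolyTime input output
polyTime {input = input} (poly p (t , t≡) r) F≡ = p , t , λ a →
  let c , d , c≤ = r (input a)
  in c , subst (λ y → p ⊢ input a ⇓ y [ c ]) (F≡ a) d , ≤-trans c≤ (≤-reflexive (sym (t≡ _)))

idP : Poly id
idP = poly `id idᴾ λ x → _ , id⇓ , ≤-refl

leftP : Poly left
leftP = poly `left idᴾ λ x → _ , left⇓ , ≤-refl

rightP : Poly right
rightP = poly `right idᴾ λ x → _ , right⇓ , ≤-refl

-- `q` is specified only on values of `F`. `foldlP` needs this freedom, because its loop is analysed
-- only on triples of environment, state and list.
seqP : ∀ {F H} → Poly F → ∀ q {u} → IsPolynomial u →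
       (∀ x → ∃ λ c → (q ⊢ F x ⇓ H x [ c ]) × c ≤ u (size (F x))) → Poly H
seqP {F} (poly p tᴾ r) q uᴾ s = poly (p ⨾ q) (tᴾ +ᴾ uᴾ ∘ᴾ tᴾ) λ x →
  let c , d , c≤ = r x
      c′ , d′ , c′≤ = s x
  in c + c′ , seq⇓ d d′ , +-mono-≤ c≤ (≤-trans c′≤ (monotone uᴾ (≤-trans (size-output d) c≤)))

infixr 9 _∘P_

_∘P_ : ∀ {F G} → Poly G → Poly F → Poly (λ x → G (F x))
_∘P_ {F} (poly q u s) π = seqP π q u (λ x → s (F x))

infixr 5 _∙P_

_∙P_ : ∀ {F G} → Poly F → Poly G → Poly (λ x → F x ∙ G x)
poly p t r ∙P poly q u s = poly ⟨ p , q ⟩ (constᴾ 1 +ᴾ (t +ᴾ u)) λ x →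
  let c , d , c≤ = r x
      c′ , d′ , c′≤ = s x
  in suc (c + c′) , pair⇓ d d′ , s≤s (+-mono-≤ c≤ c′≤)

constP : ∀ y → Poly (λ _ → y)
constP nil     = poly `nil idᴾ λ x → _ , nil⇓ , ≤-refl
constP (y ∙ z) = constP y ∙P constP z

ifT : Tree → Tree → Tree → Tree
ifT nil     y z = z
ifT (_ ∙ _) y z = y

ifP : ∀ {B F G} → Poly B → Poly F → Poly G → Poly (λ x → ifT (B x) (F x) (G x))
ifP {B} {F} {G} (poly b v w) (poly p t r) (poly q u s) =
  poly (`if b then p else q) (v +ᴾ (t +ᴾ u)) λ x →
    let _ , db , b≤ = w x
        _ , dp , p≤ = r x
        _ , dq , q≤ = s x
    in branch x db dp dq (+-mono-≤ b≤ (≤-trans p≤ (m≤m+n _ _))) (+-mono-≤ b≤ (≤-trans q≤ (m≤n+m _ _)))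
  where
  branch : ∀ x {cb cp cq M} → b ⊢ x ⇓ B x [ cb ] → p ⊢ x ⇓ F x [ cp ] → q ⊢ x ⇓ G x [ cq ] →
           cb + cp ≤ M → cb + cq ≤ M →
           ∃ λ c → (`if b then p else q ⊢ x ⇓ ifT (B x) (F x) (G x) [ c ]) × c ≤ M
  branch x db dp dq p≤ q≤ with B x
  ... | nil   = _ , else⇓ db dq , q≤
  ... | _ ∙ _ = _ , then⇓ db dp , p≤

-- A tree is read as the list of left subtrees along its right spine.

foldlT : (Tree → Tree) → Tree → Tree → Tree → Tree
foldlT F e s nil     = s
foldlT F e s (h ∙ t) = foldlT F e (F (e ∙ s ∙ h ∙ t)) t

-- The growth of the state is additive, with an increment independent of the
-- state; this keeps it polynomial along the whole loop.
Additive : (Tree → Tree) → Set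
Additive F = Σ (ℕ → ℕ) λ a → IsPolynomial a × ∀ e s h t →
  size (F (e ∙ s ∙ h ∙ t)) ≤ size s + a (size (e ∙ h ∙ t))

-- The size of the triple, plus one increment of the state for each remaining element, is a
-- potential that never rises. Hence one bound `M` covers every triple that the loop meets, and the
-- cost is the number of rounds times a polynomial in `M`.
foldlP : ∀ {F} → Poly F → Additive F → Poly (λ x → foldlT F (left x) (left (right x)) (right (right x)))
foldlP {F} (poly p {t} tᴾ r) (a , aᴾ , grows) =
  seqP (leftP ∙P (leftP ∘P rightP) ∙P (rightP ∘P rightP))
    ((`while test loop body) ⨾ (`right ⨾ `left)) boundᴾ
    (λ x → runs (left x) (left (right x)) (right (right x)))
  where
  test body : Program
  test = `right ⨾ `right
  body = ⟨ `left , ⟨ p , `right ⨾ `right ⨾ `right ⟩ ⟩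

  spine : Tree → ℕ
  spine nil     = 0
  spine (_ ∙ t) = suc (spine t)

  spine≤size : ∀ x → spine x ≤ size x
  spine≤size nil     = z≤n
  spine≤size (_ ∙ t) = s≤s (≤-trans (spine≤size t) (m≤n+m _ _))

  -- Two pairings, one run of `p`, and six primitives on trees of size at most `M`: two in `test`
  -- and four around `p` in `body`.
  round : ℕ → ℕ
  round M = 2 + (t M + 6 * M)

  arith₁ : ∀ e s u → suc (e + suc (s + u)) ≡ e + u + 2 + s
  arith₁ = solve-∀

  arith₂ : ∀ M T → M + M + suc (M + suc (T + (M + M + M))) ≡ 2 + (T + 6 * M)
  arith₂ = solve-∀

  arith₃ : ∀ M T → M + M + M + (3 * M + (2 + T)) ≡ 2 + (T + 6 * M)
  arith₃ = solve-∀

  loops : ∀ e s todo M A → size e + size todo + 2 + (size s + spine todo * A) ≤ M →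
          a (suc (size e + size todo)) ≤ A →
          ∃ λ c → (`while test loop body ⊢ e ∙ s ∙ todo ⇓ e ∙ foldlT F e s todo ∙ nil [ c ]) ×
                  c ≤ suc (spine todo) * round M × size (e ∙ foldlT F e s todo ∙ nil) ≤ M
  loops e s nil M A fits small = _ , stop⇓ (seq⇓ right⇓ right⇓) , cost , state≤M
    where
    x = e ∙ s ∙ nil

    state≤M : size x ≤ M
    state≤M = ≤-trans (≤-reflexive (arith₁ (size e) (size s) 1))
      (≤-trans (+-monoʳ-≤ (size e + 1 + 2) (m≤m+n _ _)) fits)

    cost : size x + size (right x) + size x ≤ suc 0 * round M
    cost = ≤-trans (+-mono-≤ (+-mono-≤ state≤M (≤-trans (size-right x) state≤M)) state≤M)
      (≤-trans (m≤m+n _ _) (≤-reflexive (trans (arith₃ M (t M)) (sym (+-identityʳ _)))))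
  loops e s (h ∙ todo) M A fits small =
    let c , d , c≤ = r x
        c′ , d′ , c′≤ , state≤M = loops e (F x) todo M A fits′ small′
    in _ , loop⇓ (seq⇓ right⇓ right⇓)
                 (pair⇓ left⇓ (pair⇓ d (seq⇓ (seq⇓ right⇓ right⇓) right⇓))) d′ ,
       +-mono-≤ (≤-trans (+-mono-≤ (+-mono-≤ x≤M rx≤M)
                            (s≤s (+-mono-≤ x≤M (s≤s (+-mono-≤ (≤-trans c≤ (monotone tᴾ x≤M))
                              (+-mono-≤ (+-mono-≤ x≤M rx≤M) rrx≤M))))))
                  (≤-reflexive (arith₂ M (t M)))) c′≤ ,
       state≤M
    where
    x = e ∙ s ∙ h ∙ todo

    x≤M : size x ≤ M
    x≤M = ≤-trans (≤-reflexive (arith₁ (size e) (size s) (size (h ∙ todo))))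
      (≤-trans (+-monoʳ-≤ (size e + size (h ∙ todo) + 2) (m≤m+n _ _)) fits)

    rx≤M : size (right x) ≤ M
    rx≤M = ≤-trans (size-right x) x≤M

    rrx≤M : size (right (right x)) ≤ M
    rrx≤M = ≤-trans (size-right (right x)) rx≤M

    todo≤ : size todo ≤ size (h ∙ todo)
    todo≤ = size-right (h ∙ todo)

    fits′ : size e + size todo + 2 + (size (F x) + spine todo * A) ≤ M
    fits′ = ≤-trans (+-mono-≤ (+-monoˡ-≤ 2 (+-monoʳ-≤ (size e) todo≤))
      (≤-trans (+-monoˡ-≤ (spine todo * A) (≤-trans (grows e s h todo) (+-monoʳ-≤ (size s) small)))
               (≤-reflexive (+-assoc (size s) A _)))) fits

    small′ : a (suc (size e + size todo)) ≤ A
    small′ = ≤-trans (monotone aᴾ (s≤s (+-monoʳ-≤ (size e) todo≤))) small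

  -- At most `N` rounds each add at most `a N` to the initial size `N`. In `bound`, one extra round
  -- pays for the final test and `2 * limit N` for extracting the state.
  limit bound : ℕ → ℕ
  limit N = N + N * a N
  bound N = suc N * round (limit N) + 2 * limit N

  limitᴾ : IsPolynomial limit
  limitᴾ = idᴾ +ᴾ idᴾ *ᴾ aᴾ

  boundᴾ : IsPolynomial bound
  boundᴾ = (constᴾ 1 +ᴾ idᴾ) *ᴾ (constᴾ 2 +ᴾ (tᴾ ∘ᴾ limitᴾ +ᴾ constᴾ 6 *ᴾ limitᴾ)) +ᴾ constᴾ 2 *ᴾ limitᴾ

  runs : ∀ e s todo → ∃ λ c →
         ((`while test loop body) ⨾ (`right ⨾ `left) ⊢ e ∙ s ∙ todo ⇓ foldlT F e s todo [ c ]) ×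
         c ≤ bound (size (e ∙ s ∙ todo))
  runs e s todo =
    let c , d , c≤ , out≤M = loops e s todo M (a N) fits (monotone aᴾ e+todo≤N)
    in _ , seq⇓ d (seq⇓ right⇓ left⇓) ,
       +-mono-≤ (≤-trans c≤ (*-monoˡ-≤ (round M) (s≤s spine≤N)))
                (+-mono-≤ out≤M (≤-trans (≤-trans (size-right (e ∙ foldlT F e s todo ∙ nil)) out≤M) (m≤m+n _ 0)))
    where
    N = size (e ∙ s ∙ todo)
    M = limit N

    spine≤N : spine todo ≤ N
    spine≤N = ≤-trans (spine≤size todo)
      (≤-trans (size-right (s ∙ todo)) (size-right (e ∙ s ∙ todo)))

    e+todo≤N : suc (size e + size todo) ≤ N
    e+todo≤N = s≤s (+-monoʳ-≤ (size e) (size-right (s ∙ todo)))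

    fits : size e + size todo + 2 + (size s + spine todo * a N) ≤ M
    fits = begin
      size e + size todo + 2 + (size s + spine todo * a N)  ≡⟨ sym (+-assoc (size e + size todo + 2) (size s) _) ⟩
      size e + size todo + 2 + size s + spine todo * a N    ≡⟨ cong (_+ spine todo * a N) (sym (arith₁ (size e) (size s) (size todo))) ⟩
      N + spine todo * a N                                  ≤⟨ +-monoʳ-≤ N (*-monoˡ-≤ (a N) spine≤N) ⟩
      N + N * a N                                           ≡⟨⟩
      M                                                     ∎
      where open ≤-Reasoning

-- Trees as lists

foldlᴾ : ∀ {F E S X} → Poly F → Additive F → Poly E → Poly S → Poly X →
         Poly (λ x → foldlT F (E x) (S x) (X x))
foldlᴾ π grows ε σ ξ = foldlP π grows ∘P (ε ∙P σ ∙P ξ)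

2nd 3rd 3rd⁺ : Tree → Tree
2nd x  = left (right x)
3rd⁺ x = right (right x)
3rd x  = left (3rd⁺ x)

2ndP : Poly 2nd
2ndP = leftP ∘P rightP

3rd⁺P : Poly 3rd⁺
3rd⁺P = rightP ∘P rightP

3rdP : Poly 3rd
3rdP = leftP ∘P 3rd⁺P

-- `F` sees an element together with the rest of the list. The length of that rest supplies the
-- entries of `rangeT` and the offset in `outputUnit`; with `2nd` for `F` this is plain reversal.
revMapTails : (Tree → Tree) → Tree → Tree → Tree → Tree
revMapTails F = foldlT (λ x → F (left x ∙ 3rd⁺ x) ∙ 2nd x)

revMapTailsP : ∀ {F E S X} → Poly F → Poly E → Poly S → Poly X →
               Poly (λ x → revMapTails F (E x) (S x) (X x))
revMapTailsP {F} π = foldlᴾ ((π ∘P (leftP ∙P 3rd⁺P)) ∙P 2ndP)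
  (_ , constᴾ 1 +ᴾ isPoly π , λ e s h t → ≤-trans (≤-reflexive (+-comm _ (size s)))
    (+-monoʳ-≤ (size s) (s≤s (size-Poly π (e ∙ h ∙ t)))) )

foldrT : (Tree → Tree) → Tree → Tree → Tree → Tree
foldrT F e s nil     = s
foldrT F e s (h ∙ t) = F (e ∙ h ∙ foldrT F e s t)

-- A right fold is a left fold over the reversed list, so the loop of `foldlP` is the only one that
-- has to be analysed.
foldrP : ∀ {F E S X} → Poly F →
         Σ (ℕ → ℕ) (λ a → IsPolynomial a × ∀ e h s → size (F (e ∙ h ∙ s)) ≤ size s + a (size (e ∙ h))) →
         Poly E → Poly S → Poly X → Poly (λ x → foldrT F (E x) (S x) (X x))
foldrP {F} {E} {S} {X} π (a , aᴾ , grows) ε σ ξ =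
  ext (λ x → agree (E x) (S x) (X x) nil)
  (foldlᴾ (π ∘P (leftP ∙P 3rdP ∙P 2ndP))
    (a , aᴾ , λ e s h t → ≤-trans (grows e h s)
      (+-monoʳ-≤ (size s) (monotone aᴾ (s≤s (+-monoʳ-≤ (size e) (size-left (h ∙ t)))))))
    ε σ (revMapTailsP 2ndP (constP nil) (constP nil) ξ))
  where
  agree : ∀ e s xs ys →
    foldlT (λ x → F (left x ∙ 3rd x ∙ 2nd x)) e s (revMapTails 2nd nil ys xs) ≡
    foldlT (λ x → F (left x ∙ 3rd x ∙ 2nd x)) e (foldrT F e s xs) ys
  agree e s nil     ys = refl
  agree e s (h ∙ t) ys = agree e s t (h ∙ ys)

mapT : (Tree → Tree) → Tree → Tree → Tree
mapT F e = foldrT (λ x → F (left x ∙ 2nd x) ∙ 3rd⁺ x) e nil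

mapP : ∀ {F E X} → Poly F → Poly E → Poly X → Poly (λ x → mapT F (E x) (X x))
mapP {F} π ε = foldrP ((π ∘P (leftP ∙P 2ndP)) ∙P 3rd⁺P)
  (_ , constᴾ 1 +ᴾ isPoly π , λ e h s → ≤-trans (≤-reflexive (+-comm _ (size s)))
    (+-monoʳ-≤ (size s) (s≤s (size-Poly π (e ∙ h)))) )
  ε (constP nil)

appendT : Tree → Tree → Tree
appendT xs ys = foldrT right nil ys xs

appendP : ∀ {X Y} → Poly X → Poly Y → Poly (λ x → appendT (X x) (Y x))
appendP ξ υ = foldrP rightP
  (id , idᴾ , λ e h s → ≤-trans (≤-reflexive (+-comm _ (size s)))
    (+-monoʳ-≤ (size s) (s≤s (m≤n+m _ _))))
  (constP nil) υ ξ

size-appendT : ∀ xs ys → size (appendT xs ys) ≤ size ys + size xs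
size-appendT nil     ys = m≤m+n _ _
size-appendT (h ∙ t) ys = begin
  suc (size h + size (appendT t ys))   ≤⟨ s≤s (+-monoʳ-≤ (size h) (size-appendT t ys)) ⟩
  suc (size h) + (size ys + size t)    ≡⟨ +-comm (suc (size h)) _ ⟩
  size ys + size t + suc (size h)      ≡⟨ +-assoc (size ys) _ _ ⟩
  size ys + (size t + suc (size h))    ≡⟨ cong (size ys +_) (+-comm (size t) _) ⟩
  size ys + suc (size h + size t)      ∎
  where open ≤-Reasoning

concatT : Tree → Tree
concatT = foldrT (λ x → appendT (2nd x) (3rd⁺ x)) nil nil

concatP : ∀ {X} → Poly X → Poly (λ x → concatT (X x))
concatP = foldrP (appendP 2ndP 3rd⁺P)
  (id , idᴾ , λ e h s → ≤-trans (size-appendT h s) (+-monoʳ-≤ (size s) (size-right (e ∙ h))))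
  (constP nil) (constP nil)

dropT : Tree → Tree → Tree
dropT k xs = foldlT (λ x → right (2nd x)) nil xs k

dropP : ∀ {K X} → Poly K → Poly X → Poly (λ x → dropT (K x) (X x))
dropP κ ξ = foldlᴾ (rightP ∘P 2ndP)
  (_ , constᴾ 0 , λ e s h t → ≤-trans (size-right s) (m≤m+n _ _)) (constP nil) ξ κ

lookupT : Tree → Tree → Tree
lookupT xs k = left (dropT k xs)

lookupP : ∀ {X K} → Poly X → Poly K → Poly (λ x → lookupT (X x) (K x))
lookupP ξ κ = leftP ∘P dropP κ ξ

rangeT : Tree → Tree
rangeT = revMapTails 3rd⁺ nil nil

rangeP : ∀ {K} → Poly K → Poly (λ x → rangeT (K x))
rangeP = revMapTailsP 3rd⁺P (constP nil) (constP nil)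

replicateT : Tree → Tree → Tree
replicateT k x = mapT left x k

replicateP : ∀ {K X} → Poly K → Poly X → Poly (λ x → replicateT (K x) (X x))
replicateP κ ξ = mapP leftP ξ κ

-- Unary numbers are lists of `nil`, so one function is both multiplication (`mulT-ℕ`) and
-- repetition of code (`mulT-code`).
mulT : Tree → Tree → Tree
mulT m n = concatT (replicateT m n)

mulP : ∀ {M N} → Poly M → Poly N → Poly (λ x → mulT (M x) (N x))
mulP μ ν = concatP (replicateP μ ν)

allT : Tree → Tree
allT = foldrT (λ x → ifT (2nd x) (3rd⁺ x) nil) nil (nil ∙ nil)

allP : ∀ {X} → Poly X → Poly (λ x → allT (X x))
allP = foldrP (ifP 2ndP 3rd⁺P (constP nil))
  (_ , constᴾ 0 , λ e h s → ≤-trans (branch h s) (m≤m+n _ _))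
  (constP nil) (constP (nil ∙ nil))
  where
  branch : ∀ h s → size (ifT h s nil) ≤ size s
  branch nil     s = size>0 s
  branch (_ ∙ _) s = ≤-refl

encodeList : {X : Set} → (X → Tree) → List X → Tree
encodeList enc []       = nil
encodeList enc (x ∷ xs) = enc x ∙ encodeList enc xs

mapT-encodeList : ∀ {X Y : Set} {enc : X → Tree} {enc′ : Y → Tree} {F e} {f : X → Y} →
                  (∀ x → F (e ∙ enc x) ≡ enc′ (f x)) →
                  ∀ xs → mapT F e (encodeList enc xs) ≡ encodeList enc′ (List.map f xs)
mapT-encodeList F≡ []       = refl
mapT-encodeList {F = F} {e} F≡ (x ∷ xs) = cong₂ _∙_ (F≡ x) (mapT-encodeList {F = F} {e} F≡ xs)

appendT-encodeList : ∀ {X : Set} (enc : X → Tree) xs ys →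
                     appendT (encodeList enc xs) (encodeList enc ys) ≡ encodeList enc (xs ++ ys)
appendT-encodeList enc []       ys = refl
appendT-encodeList enc (x ∷ xs) ys = cong (enc x ∙_) (appendT-encodeList enc xs ys)

concatT-encodeList : ∀ {X : Set} (enc : X → Tree) xss →
                     concatT (encodeList (encodeList enc) xss) ≡ encodeList enc (List.concat xss)
concatT-encodeList enc []         = refl
concatT-encodeList enc (xs ∷ xss) =
  trans (cong (appendT (encodeList enc xs)) (concatT-encodeList enc xss)) (appendT-encodeList enc xs _)

appendT-ℕ : ∀ m n → appendT (encodeℕ m) (encodeℕ n) ≡ encodeℕ (m + n)
appendT-ℕ zero    n = refl
appendT-ℕ (suc m) n = cong (nil ∙_) (appendT-ℕ m n)

mulT-ℕ : ∀ m n → mulT (encodeℕ m) (encodeℕ n) ≡ encodeℕ (m * n)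
mulT-ℕ zero    n = refl
mulT-ℕ (suc m) n = trans (cong (appendT (encodeℕ n)) (mulT-ℕ m n)) (appendT-ℕ n (m * n))

dropT-nil : ∀ k → dropT k nil ≡ nil
dropT-nil nil     = refl
dropT-nil (h ∙ t) = dropT-nil t

dropT-ℕ : ∀ k n → dropT (encodeℕ k) (encodeℕ n) ≡ encodeℕ (n ∸ k)
dropT-ℕ zero    n       = refl
dropT-ℕ (suc k) zero    = dropT-nil (encodeℕ k)
dropT-ℕ (suc k) (suc n) = dropT-ℕ k n

rangeT-ℕ : ∀ n → rangeT (encodeℕ n) ≡ encodeList encodeℕ (upTo n)
rangeT-ℕ n = trans (onto n []) (cong (encodeList encodeℕ) (++-identityʳ (upTo n)))
  where
  onto : ∀ n ys → revMapTails 3rd⁺ nil (encodeList encodeℕ ys) (encodeℕ n) ≡ encodeList encodeℕ (upTo n ++ ys)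
  onto zero    ys = refl
  onto (suc n) ys = trans (onto n (n ∷ ys))
    (cong (encodeList encodeℕ) (trans (sym (++-assoc (upTo n) (n ∷ []) ys)) (cong (_++ ys) (applyUpTo-∷ʳ id n))))

mapT-range : ∀ {X : Set} {enc : X → Tree} {F e} {f : ℕ → X} → (∀ i → F (e ∙ encodeℕ i) ≡ enc (f i)) →
             ∀ n → mapT F e (rangeT (encodeℕ n)) ≡ encodeList enc (applyUpTo f n)
mapT-range {enc = enc} {F} {e} {f} F≡ n = trans (cong (mapT F e) (rangeT-ℕ n))
  (trans (mapT-encodeList {F = F} {e} F≡ (upTo n)) (cong (encodeList enc) (map-applyUpTo id f n)))

-- Straight-line code

-- Gates with untyped wire indices: code can be concatenated, repeated and generated by a program
-- without carrying proofs that its indices are in range.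
data Instruction : Set where
  const  : Bool → Instruction
  neg    : ℕ → Instruction
  and or : ℕ → ℕ → Instruction

Code : Set
Code = List Instruction

infix 4 _[_]↦_ _⊢_⇒_

data _[_]↦_ : List Bool → ℕ → Bool → Set where
  here  : ∀ {b ρ} → (b ∷ ρ) [ 0 ]↦ b
  there : ∀ {b c ρ k} → ρ [ k ]↦ b → (c ∷ ρ) [ suc k ]↦ b

data _⊢_⇒_ (ρ : List Bool) : Instruction → Bool → Set where
  const : ∀ {b} → ρ ⊢ const b ⇒ b
  neg   : ∀ {i b} → ρ [ i ]↦ b → ρ ⊢ neg i ⇒ not b
  and   : ∀ {i j b c} → ρ [ i ]↦ b → ρ [ j ]↦ c → ρ ⊢ and i j ⇒ b ∧ c
  or    : ∀ {i j b c} → ρ [ i ]↦ b → ρ [ j ]↦ c → ρ ⊢ or i j ⇒ b ∨ c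

-- A run exists only if every wire index is in range, so that it also
-- witnesses that the code is a well-formed circuit.
data Run : Code → List Bool → List Bool → Set where
  []  : ∀ {ρ} → Run [] ρ ρ
  _∷_ : ∀ {g gs b ρ ρ′} → ρ ⊢ g ⇒ b → Run gs (b ∷ ρ) ρ′ → Run (g ∷ gs) ρ ρ′

infix 4 _∶_▹_

_∶_▹_ : Code → List Bool → (List Bool → Set) → Set
gs ∶ ρ ▹ P = ∃ λ ρ′ → Run gs ρ ρ′ × P ρ′

run-++ : ∀ {gs hs ρ σ τ} → Run gs ρ σ → Run hs σ τ → Run (gs ++ hs) ρ τ
run-++ []       s = s
run-++ (d ∷ ds) s = d ∷ run-++ ds s

infixr 4 _then_

_then_ : ∀ {gs hs ρ P Q} → gs ∶ ρ ▹ P → (∀ {σ} → Run gs ρ σ → P σ → hs ∶ σ ▹ Q) → (gs ++ hs) ∶ ρ ▹ Q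
(σ , r , p) then k = let τ , s , q = k r p in τ , run-++ r s , q

weaken : ∀ {P Q : List Bool → Set} {gs ρ} → (∀ {σ} → Run gs ρ σ → P σ → Q σ) → gs ∶ ρ ▹ P → gs ∶ ρ ▹ Q
weaken f (σ , r , p) = σ , r , f r p

↦-functional : ∀ {ρ k b c} → ρ [ k ]↦ b → ρ [ k ]↦ c → b ≡ c
↦-functional here      here      = refl
↦-functional (there p) (there q) = ↦-functional p q

⇒-functional : ∀ {ρ g b c} → ρ ⊢ g ⇒ b → ρ ⊢ g ⇒ c → b ≡ c
⇒-functional const     const       = refl
⇒-functional (neg p)   (neg q)     = cong not (↦-functional p q)
⇒-functional (and p q) (and p′ q′) = cong₂ _∧_ (↦-functional p p′) (↦-functional q q′)
⇒-functional (or p q)  (or p′ q′)  = cong₂ _∨_ (↦-functional p p′) (↦-functional q q′)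

run-functional : ∀ {gs ρ σ τ} → Run gs ρ σ → Run gs ρ τ → σ ≡ τ
run-functional []       []       = refl
run-functional (d ∷ ds) (e ∷ es) with refl ← ⇒-functional d e = run-functional ds es

Shifts : ℕ → List Bool → List Bool → Set
Shifts k ρ σ = ∀ {i b} → ρ [ i ]↦ b → σ [ k + i ]↦ b

run-shifts : ∀ {gs ρ σ} → Run gs ρ σ → Shifts (length gs) ρ σ
run-shifts []       p = p
run-shifts {gs = _ ∷ gs} {σ = σ} (d ∷ ds) {i} {b} p =
  subst (λ k → σ [ k ]↦ b) (+-suc (length gs) i) (run-shifts ds (there p))

shifts-trans : ∀ {k l ρ σ τ} → Shifts k ρ σ → Shifts l σ τ → Shifts (l + k) ρ τ
shifts-trans {k} {l} {τ = τ} s t {i} {b} p = subst (λ m → τ [ m ]↦ b) (sym (+-assoc l k i)) (t (s p))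

at : ∀ {ρ i j b} → i ≡ j → ρ [ i ]↦ b → ρ [ j ]↦ b
at refl p = p

as : ∀ {ρ i b c} → b ≡ c → ρ [ i ]↦ b → ρ [ i ]↦ c
as refl p = p

++-↦ : ∀ xs {ρ k b} → ρ [ k ]↦ b → (xs ++ ρ) [ length xs + k ]↦ b
++-↦ []       p = p
++-↦ (x ∷ xs) p = there (++-↦ xs p)

-- Input words have stride one and results of blocks have stride five, the number of wires that
-- `muxUnit` pushes; `andUnit` and `outputUnit` are padded to five.
Strided : ℕ → ∀ {n} → List Bool → ℕ → Word n → Set
Strided stride ρ d []      = ⊤
Strided stride ρ d (x ∷ w) = ρ [ d ]↦ x × Strided stride ρ (stride + d) w

strided-shift : ∀ {s n ρ σ k d e} (w : Word n) → Shifts k ρ σ → k + d ≡ e → Strided s ρ d w → Strided s σ e w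
strided-shift []      sh eq _       = tt
strided-shift {s} {k = k} {d} (x ∷ w) sh refl (p , ps) = sh p , strided-shift w sh (lemma k s d) ps
  where
  lemma : ∀ k s d → k + (s + d) ≡ s + (k + d)
  lemma = solve-∀

times : ℕ → Code → Code
times zero    gs = []
times (suc k) gs = gs ++ times k gs

times-suc : ∀ k gs → times k gs ++ gs ≡ times (suc k) gs
times-suc zero    gs = sym (++-identityʳ gs)
times-suc (suc k) gs = trans (++-assoc gs (times k gs) gs) (cong (gs ++_) (times-suc k gs))

length-times : ∀ k gs → length (times k gs) ≡ k * length gs
length-times zero    gs = refl
length-times (suc k) gs = trans (length-++ gs) (cong (length gs +_) (length-times k gs))

times-last : ∀ k {gs ρ P} → (times k gs ++ gs) ∶ ρ ▹ P → times (suc k) gs ∶ ρ ▹ P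
times-last k {gs} {ρ} {P} = subst (λ hs → hs ∶ ρ ▹ P) (times-suc k gs)

pad : ∀ k ρ → times k (const true ∷ []) ∶ ρ ▹ λ _ → ⊤
pad zero    ρ = ρ , [] , tt
pad (suc k) ρ = let σ , r , _ = pad k (true ∷ ρ) in σ , const ∷ r , tt

copies : ∀ k {ρ b} → ρ [ 0 ]↦ b → times k (or 0 0 ∷ []) ∶ ρ ▹ (_[ 0 ]↦ b)
copies zero    p = _ , [] , p
copies (suc k) {ρ} {b} p =
  let σ , r , q = copies k (subst (λ c → ((b ∨ b) ∷ ρ) [ 0 ]↦ c) (∨-idem b) here) in σ , or p p ∷ r , q

-- Conjunction, selection and copying of words in straight-line code

allFrom : ∀ {n} → ℕ → Word n → Bool
allFrom t       []      = true
allFrom zero    (x ∷ w) = x ∧ allFrom zero w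
allFrom (suc t) (x ∷ w) = allFrom t w

andUnit : ℕ → Code
andUnit i = and i 0 ∷ times 4 (or 0 0 ∷ [])

-- The hypothesis `x + 5 ≡ a + m * 5`, here and below, places `x` at the last of `m` bits that start
-- at `a`, without truncated subtraction.
suc-+5 : ∀ {x a m} → x + 5 ≡ a + suc m * 5 → x ≡ m * 5 + a
suc-+5 {x} {a} {m} eq = +-cancelʳ-≡ 5 x (m * 5 + a) (trans eq (lemma a m))
  where
  lemma : ∀ a m → a + suc m * 5 ≡ m * 5 + a + 5
  lemma = solve-∀

tail-+5 : ∀ {x a m} → x + 5 ≡ a + suc m * 5 → x + 5 ≡ (5 + a) + m * 5
tail-+5 {x} {a} {m} eq = trans eq (lemma a m)
  where
  lemma : ∀ a m → a + suc m * 5 ≡ (5 + a) + m * 5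
  lemma = solve-∀

-- Every unit pushes five wires and bits are processed from the last one down,
-- so a word with stride five is read at a constant index.
conjunction : ∀ {m} (w : Word m) {ρ a x} → ρ [ 0 ]↦ true → Strided 5 ρ a w → x + 5 ≡ a + m * 5 →
              times m (andUnit x) ∶ ρ ▹ (_[ 0 ]↦ allFrom 0 w)
conjunction {zero}  []      top at-w eq = _ , [] , top
conjunction {suc m} (b ∷ w) {ρ} {a} {x} top (at-b , at-w) eq =
  times-last m (conjunction w top at-w (tail-+5 {x} {a} {m} eq) then λ {σ} r top′ →
    let i≡ : length (times m (andUnit x)) + a ≡ x
        i≡ = trans (cong (_+ a) (length-times m (andUnit x))) (sym (suc-+5 {x} {a} {m} eq))
        τ , s , top″ = copies 4 {(b ∧ allFrom 0 w) ∷ σ} here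
    in τ , and (at i≡ (run-shifts r at-b)) top′ ∷ s , top″)

-- The index `x` points to the last bit, so leaving out the first `suc t` bits changes only the
-- number of units.
conjunctionFrom : ∀ {n} t (w : Word n) {ρ a x} → ρ [ 0 ]↦ true → Strided 5 ρ a w → x + 5 ≡ a + n * 5 →
                   times (n ∸ suc t) (andUnit x) ∶ ρ ▹ (_[ 0 ]↦ allFrom (suc t) w)
conjunctionFrom t       []      top at-w eq = _ , [] , top
conjunctionFrom {suc n} zero (b ∷ w) {a = a} {x} top (_ , at-w) eq =
  conjunction w top at-w (tail-+5 {x} {a} {n} eq)
conjunctionFrom {suc n} (suc t) (b ∷ w) {a = a} {x} top (_ , at-w) eq =
  conjunctionFrom t w top at-w (tail-+5 {x} {a} {n} eq)

-- The selector is expected at 0. The last gate copies it back there for the next unit, which leaves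
-- the selected bit at 1.
muxUnit : ℕ → ℕ → Code
muxUnit i j = and 0 i ∷ neg 1 ∷ and 0 (2 + j) ∷ or 0 2 ∷ or 4 4 ∷ []

mux≡ : ∀ q (b c : Bool) → (not q ∧ c) ∨ (q ∧ b) ≡ (if q then b else c)
mux≡ false b c = ∨-identityʳ c
mux≡ true  b c = refl

if-∷ : ∀ q {m} b c (v w : Word m) → (if q then b ∷ v else c ∷ w) ≡ (if q then b else c) ∷ (if q then v else w)
if-∷ false b c v w = refl
if-∷ true  b c v w = refl

selection : ∀ {m} q (v w : Word m) {ρ a c i j} → ρ [ 0 ]↦ q → Strided 5 ρ a v → Strided 5 ρ c w →
            i + 5 ≡ a + m * 5 → j + 5 ≡ c + m * 5 →
            times m (muxUnit i j) ∶ ρ ▹ λ σ → σ [ 0 ]↦ q × Strided 5 σ 1 (if q then v else w)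
selection {zero}  q []      []      top _ _ _ _ = _ , [] , top , (case q)
  where
  case : ∀ q {ρ} → Strided 5 ρ 1 (if q then [] else [])
  case false = tt
  case true  = tt
selection {suc m} q (b ∷ v) (d ∷ w) {ρ} {a} {c} {i} {j} top (at-b , at-v) (at-d , at-w) i≡ j≡ =
  times-last m (selection q v w top at-v at-w (tail-+5 {i} {a} {m} i≡) (tail-+5 {j} {c} {m} j≡) then λ {σ} r (top′ , at-if) →
    let len : ∀ a → length (times m (muxUnit i j)) + a ≡ m * 5 + a
        len a = cong (_+ a) (length-times m (muxUnit i j))
        b′ = at (trans (len a) (sym (suc-+5 {i} {a} {m} i≡))) (run-shifts r at-b)
        d′ = at (trans (len c) (sym (suc-+5 {j} {c} {m} j≡))) (run-shifts r at-d)
        unit : Run (muxUnit i j) σ _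
        unit = and top′ b′ ∷ neg (there top′) ∷ and here (there (there d′)) ∷ or here (there (there here)) ∷
               or (there (there (there (there top′)))) (there (there (there (there top′)))) ∷ []
    in _ , unit , as (∨-idem q) here ,
       subst (Strided 5 _ 1) (sym (if-∷ q b d v w))
         (as (mux≡ q b d) (there here) ,
          strided-shift (if q then v else w) (run-shifts unit) refl at-if))

-- Copying starts at the last bit, and every copy pushes one wire, which moves the preceding bit to
-- the same index `k`.
copyWord : ∀ {n} (w : Word n) {ρ a k} → Strided 1 ρ a w → k + 1 ≡ a + n →
           Run (times n (or k k ∷ [])) ρ (toList w ++ ρ)
copyWord []      _ _ = []
copyWord {suc n} (b ∷ w) {ρ} {a} {k} (at-b , at-w) eq =
  subst (λ gs → Run gs ρ (b ∷ toList w ++ ρ)) (times-suc n _)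
    (run-++ (copyWord w at-w (trans eq (+-suc a n)))
      (subst (λ c → Run (or k k ∷ []) (toList w ++ ρ) (c ∷ toList w ++ ρ)) (∨-idem b) (or b′ b′ ∷ [])))
  where
  k≡ : length (toList w) + a ≡ k
  k≡ = trans (cong (_+ a) (length-toList w)) (trans (+-comm n a)
         (+-cancelʳ-≡ 1 (a + n) k (trans (trans (+-comm (a + n) 1) (sym (+-suc a n))) (sym eq))))

  b′ = at k≡ (++-↦ (toList w) at-b)

-- Simulation of a given circuit

instruction : ∀ {w} → Gate w → Instruction
instruction (const b) = const b
instruction (neg i)   = neg (toℕ i)
instruction (and i j) = and (toℕ i) (toℕ j)
instruction (or i j)  = or (toℕ i) (toℕ j)

code : ∀ {m w} → Gates m w → Code
code []       = []
code (g ∷ gs) = instruction g ∷ code gs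

length-code : ∀ {m w} (gs : Gates m w) → length (code gs) ≡ #gates gs
length-code []       = refl
length-code (g ∷ gs) = cong suc (length-code gs)

lookup-↦ : ∀ {w} (ρ : Vec Bool w) {σ} i → (toList ρ ++ σ) [ toℕ i ]↦ lookup ρ i
lookup-↦ (x ∷ ρ) Fin.zero    = here
lookup-↦ (x ∷ ρ) (Fin.suc i) = there (lookup-↦ ρ i)

run-instruction : ∀ {w} (g : Gate w) ρ {σ} → (toList ρ ++ σ) ⊢ instruction g ⇒ evalGate g ρ
run-instruction (const b) ρ = const
run-instruction (neg i)   ρ = neg (lookup-↦ ρ i)
run-instruction (and i j) ρ = and (lookup-↦ ρ i) (lookup-↦ ρ j)
run-instruction (or i j)  ρ = or (lookup-↦ ρ i) (lookup-↦ ρ j)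

-- De Bruijn indices make the code of a circuit insensitive to wires below its inputs.
run-code : ∀ {m w} (gs : Gates m w) ρ {σ} → Run (code gs) (toList ρ ++ σ) (toList (evalGates gs ρ) ++ σ)
run-code []       ρ = []
run-code (g ∷ gs) ρ = run-instruction g ρ ∷ run-code gs (evalGate g ρ ∷ ρ)

-- The constants pad to five wires and put the copied bit at 1, where `muxUnit` leaves its result.
outputUnit : ℕ → Code
outputUnit i = times 3 (const true ∷ []) ++ or (3 + i) (3 + i) ∷ const true ∷ []

-- The `n` later outputs come first and have pushed five wires each, hence the offset `n * 5`.
outputCode : ∀ {w n} → Vec (Fin w) n → Code
outputCode []                = []
outputCode {n = suc n} (o ∷ os) = outputCode os ++ outputUnit (n * 5 + toℕ o)

length-outputCode : ∀ {w n} (os : Vec (Fin w) n) → length (outputCode os) ≡ n * 5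
length-outputCode [] = refl
length-outputCode {n = suc n} (o ∷ os) =
  trans (length-++ (outputCode os)) (trans (cong (_+ 5) (length-outputCode os)) (+-comm (n * 5) 5))

run-outputs : ∀ {w n} (ρ : Vec Bool w) {σ} (os : Vec (Fin w) n) →
              outputCode os ∶ toList ρ ++ σ ▹ λ τ → Strided 5 τ 1 (Vec.map (lookup ρ) os)
run-outputs ρ []       = _ , [] , tt
run-outputs {n = suc n} ρ (o ∷ os) = run-outputs ρ os then λ {τ} r at-os →
  let o′ = at (cong (_+ toℕ o) (length-outputCode os)) (run-shifts r (lookup-↦ ρ o))
      unit : Run (outputUnit (n * 5 + toℕ o)) τ _
      unit = const ∷ const ∷ const ∷ or (there (there (there o′))) (there (there (there o′))) ∷ const ∷ []
  in _ , unit , as (∨-idem _) (there here) , strided-shift (Vec.map (lookup ρ) os) (run-shifts unit) refl at-os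

-- The circuits

select : ∀ {n} → ℕ → Word n → Word n → Word n
select t v w = if allFrom (suc t) w then v else w

module Elimination {n : ℕ} (c : Word n → Word n) (a : ℕ → Word n) where

  -- `reduce t` is Cₜ and `pivot t` is vₜ.
  reduce : ℕ → Word n → Word n
  reduce zero    x = c x
  reduce (suc t) x = select t (reduce t (a t)) (reduce t x)

  pivot : ℕ → Word n
  pivot t = reduce t (a t)

open Elimination public

iterated : ∀ (f : ℕ → Code) n (I : ℕ → List Bool → Set) →
           (∀ t → t < n → ∀ {ρ} → I t ρ → f t ∶ ρ ▹ I (suc t)) →
           ∀ {ρ} → I 0 ρ → concat (applyUpTo f n) ∶ ρ ▹ I n
iterated f zero    I step i = _ , [] , i
iterated f (suc n) I step i = step 0 (s≤s z≤n) i then λ _ →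
  iterated (f ∘ suc) n (I ∘ suc) (λ t t<n → step (suc t) (s≤s t<n))

length-iterated : ∀ (f : ℕ → Code) n {M} → (∀ t → t < n → length (f t) ≤ M) → length (concat (applyUpTo f n)) ≤ n * M
length-iterated f zero    f≤ = z≤n
length-iterated f (suc n) f≤ = ≤-trans (≤-reflexive (length-++ (f 0)))
  (+-mono-≤ (f≤ 0 (s≤s z≤n)) (length-iterated (f ∘ suc) n (λ t t<n → f≤ (suc t) (s≤s t<n))))

private
  eval-length : ∀ n s → (n * 4 + 1) * 1 + (n * 1 + (s + n * 5)) ≡ suc (s + n * 10)
  eval-length = solve-∀

  select-length : ∀ d t s n → (s + 1) * 1 + (d * 5 + (t * 5 * 1 + n * 5)) ≡ suc (s + ((d + t) * 5 + n * 5))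
  select-length = solve-∀

  select-length′ : ∀ s n → suc (s + (n * 5 + n * 5)) ≡ suc (s + n * 10)
  select-length′ = solve-∀

  prefix-length : ∀ t d s → t * 5 * 1 + (d * 5 + (s + 1)) ≡ s + 1 + (d + t) * 5
  prefix-length = solve-∀

  read-index : ∀ {n n⁻} → n ≡ suc n⁻ → ∀ d → d + (n * 4 + 1) + n⁻ + 1 ≡ n * 4 + 1 + d + n
  read-index {n⁻ = n⁻} refl d = lemma n⁻ d
    where
    lemma : ∀ m d → d + (suc m * 4 + 1) + m + 1 ≡ suc m * 4 + 1 + d + suc m
    lemma = solve-∀

  and-index : ∀ {n n⁻} → n ≡ suc n⁻ → ∀ s d → d + (s + 1) + n⁻ * 5 + 5 ≡ s + 1 + d + n * 5
  and-index {n⁻ = n⁻} refl s d = lemma n⁻ s d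
    where
    lemma : ∀ m s d → d + (s + 1) + m * 5 + 5 ≡ s + 1 + d + suc m * 5
    lemma = solve-∀

  mux-index : ∀ {n n⁻} → n ≡ suc n⁻ → ∀ s d → d + (s + 1 + n * 5) + n⁻ * 5 + 5 ≡ s + 1 + n * 5 + d + n * 5
  mux-index {n⁻ = n⁻} refl s d = lemma n⁻ s d
    where
    lemma : ∀ m s d → d + (s + 1 + suc m * 5) + m * 5 + 5 ≡ s + 1 + suc m * 5 + d + suc m * 5
    lemma = solve-∀

  slot-index : ∀ j m B {R} → j + suc m ≡ R → m * B + (suc j * B + 1) ≡ R * B + 1
  slot-index j m B refl = lemma j m B
    where
    lemma : ∀ j m B → m * B + (suc j * B + 1) ≡ (j + suc m) * B + 1
    lemma = solve-∀

length-++₄ : ∀ (as bs cs ds : Code) → length (as ++ bs ++ cs ++ ds) ≡ length as + (length bs + (length cs + length ds))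
length-++₄ as bs cs ds = trans (length-++ as) (cong (length as +_)
  (trans (length-++ bs) (cong (length bs +_) (length-++ cs))))

module Generator (n : ℕ) (1≤n : 1 ≤ n) (C : Circuit n n) where

  n⁻ s B : ℕ
  n⁻ = n ∸ 1
  s  = length (code (gates C))
  B  = suc (s + n * 10)

  n≡ : n ≡ suc n⁻
  n≡ = sym (m+[n∸m]≡n 1≤n)

  -- Every block pushes B wires and leaves bit b of its result at position 1 + 5b,
  -- so consecutive results are B wires apart.
  Slot : List Bool → ℕ → Word n → Set
  Slot ρ i w = Strided 5 ρ (i * B + 1) w

  -- The padding must come first: `code (gates C)` expects its inputs on top, and the result has to
  -- end the block. Its length `n * 4 + 1` matches the length of `selectBlock`.
  evalBlock : ℕ → Code
  evalBlock d =
    times (n * 4 + 1) (const true ∷ []) ++ times n (or k k ∷ []) ++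
    code (gates C) ++ outputCode (outputs C)
    where k = d + (n * 4 + 1) + n⁻

  andAt muxAt : ℕ → ℕ
  andAt d = d + (s + 1) + n⁻ * 5
  muxAt d = d + (s + 1 + n * 5) + n⁻ * 5

  -- The `s + 1` constants stand in for the gates of `C`, and the topmost of them is the initial
  -- value of the conjunction. The `suc t * 5` copies replace the units that the conjunction skips,
  -- so the length does not depend on `t`.
  selectBlock : ℕ → ℕ → ℕ → Code
  selectBlock t d e =
    times (s + 1) (const true ∷ []) ++ times (n ∸ suc t) (andUnit (andAt e)) ++
    times (suc t * 5) (or 0 0 ∷ []) ++ times n (muxUnit (muxAt d) (muxAt e))

  length-evalBlock : ∀ d → length (evalBlock d) ≡ B
  length-evalBlock d = trans
    (length-++₄ (times (n * 4 + 1) (const true ∷ [])) (times n (or k k ∷ [])) (code (gates C)) (outputCode (outputs C)))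
    (trans (cong₂ _+_ (length-times (n * 4 + 1) (const true ∷ []))
             (cong₂ _+_ (length-times n (or k k ∷ [])) (cong (s +_) (length-outputCode (outputs C)))))
           (eval-length n s))
    where
    k = d + (n * 4 + 1) + n⁻

  length-selectBlock : ∀ t d e → t < n → length (selectBlock t d e) ≡ B
  length-selectBlock t d e t<n = trans
    (length-++₄ (times (s + 1) (const true ∷ [])) (times (n ∸ suc t) (andUnit x)) (times (suc t * 5) (or 0 0 ∷ [])) (times n (muxUnit i j)))
    (trans (cong₂ _+_ (length-times (s + 1) (const true ∷ []))
             (cong₂ _+_ (length-times (n ∸ suc t) (andUnit x))
               (cong₂ _+_ (length-times (suc t * 5) (or 0 0 ∷ [])) (length-times n (muxUnit i j)))))
      (trans (select-length (n ∸ suc t) (suc t) s n)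
        (trans (cong (λ m → suc (s + (m * 5 + n * 5))) (m∸n+n≡m t<n)) (select-length′ s n))))
    where
    x = andAt e
    i = muxAt d
    j = muxAt e

  run-evalBlock : ∀ d (x : Word n) {ρ} → Strided 1 ρ d x →
                  evalBlock d ∶ ρ ▹ λ σ → Slot σ 0 (eval C x)
  run-evalBlock d x at-x = pad (n * 4 + 1) _ then λ {σ} r _ →
    let at-x′ = strided-shift x (run-shifts r) refl at-x
        k≡ = trans (read-index n≡ d) (cong (λ l → l + d + n) (sym len))
    in copied at-x′ k≡ then λ { _ refl →
       computed then λ { _ refl → run-outputs (evalGates (gates C) x) (outputs C) } }
    where
    len : length (times (n * 4 + 1) (const true ∷ [])) ≡ n * 4 + 1
    len = trans (length-times (n * 4 + 1) (const true ∷ [])) (*-identityʳ _)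

    copied : ∀ {ρ a k} → Strided 1 ρ a x → k + 1 ≡ a + n → times n (or k k ∷ []) ∶ ρ ▹ (_≡ toList x ++ ρ)
    copied at-x k≡ = _ , copyWord x at-x k≡ , refl

    computed : ∀ {ρ} → code (gates C) ∶ toList x ++ ρ ▹ (_≡ toList (evalGates (gates C) x) ++ ρ)
    computed = _ , run-code (gates C) x , refl

  run-selectBlock : ∀ t (v w : Word n) {ρ} d e → t < n → Strided 5 ρ d v → Strided 5 ρ e w →
    selectBlock t d e ∶ ρ ▹ λ σ → Slot σ 0 (select t v w)
  run-selectBlock t v w {ρ} d e t<n at-v at-w =
    padded then λ {σ₁} r₁ top₁ →
    conjunctionFrom t w top₁ (strided-shift w (run-shifts r₁) refl at-w)
      (trans (and-index n≡ s e) (cong (λ l → l + e + n * 5) (sym len₁))) then λ {σ₂} r₂ top₂ →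
    copies (suc t * 5) top₂ then λ {σ₃} r₃ top₃ →
    let sh : Shifts (s + 1 + n * 5) ρ σ₃
        sh = subst (λ l → Shifts l ρ σ₃) len
               (λ {i b} p → shifts-trans {ρ = ρ} {σ₂} {σ₃} (λ {i b} → shifts-trans {ρ = ρ} {σ₁} {σ₂} (run-shifts r₁) (run-shifts r₂) {i} {b}) (run-shifts r₃) {i} {b} p)
    in weaken (λ _ → proj₂) (selection (allFrom (suc t) w) v w top₃
         (strided-shift v sh refl at-v) (strided-shift w sh refl at-w) (mux-index n≡ s d) (mux-index n≡ s e))
    where
    len₁ : length (times (s + 1) (const true ∷ [])) ≡ s + 1
    len₁ = trans (length-times (s + 1) (const true ∷ [])) (*-identityʳ _)

    padded : times (s + 1) (const true ∷ []) ∶ ρ ▹ (_[ 0 ]↦ true)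
    padded = subst (λ m → times m (const true ∷ []) ∶ ρ ▹ (_[ 0 ]↦ true)) (+-comm 1 s)
      (times-last s (pad s ρ then λ _ _ → _ , const ∷ [] , here))

    len : length (times (suc t * 5) (or 0 0 ∷ [])) + (length (times (n ∸ suc t) (andUnit (andAt e))) + length (times (s + 1) (const true ∷ []))) ≡ s + 1 + n * 5
    len = trans (cong₂ _+_ (length-times (suc t * 5) (or 0 0 ∷ [])) (cong₂ _+_ (length-times (n ∸ suc t) (andUnit (andAt e))) len₁))
            (trans (prefix-length (suc t) (n ∸ suc t) s) (cong (λ m → s + 1 + m * 5) (m∸n+n≡m t<n)))

  module _ (f : ℕ → Code) (R : ℕ) (new : ℕ → Word n) (length-f : ∀ m → length (f m) ≡ B) where

    -- The blocks are laid down for the slots R - 1, …, 0 in this order.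
    slots : ∀ {ρ} → (∀ m j → j + suc m ≡ R → ∀ {σ} → Shifts (m * B) ρ σ → f m ∶ σ ▹ λ τ → Slot τ 0 (new j)) →
            concat (applyUpTo f R) ∶ ρ ▹ λ σ → ∀ j → j < R → Slot σ j (new j)
    slots {ρ} block = weaken (λ {σ} _ (_ , done) j j<R → done j j (+-comm j R) j<R)
      (iterated f R I step ((λ p → p) , λ i j eq ()))
      where
      -- Each new block moves the earlier results one slot further. After `m` blocks, slot `i` holds
      -- the word of index `R - m + i`, which the equation expresses without subtraction.
      I : ℕ → List Bool → Set
      I m σ = Shifts (m * B) ρ σ × (∀ i j → j + m ≡ R + i → i < m → Slot σ i (new j))

      step : ∀ m → m < R → ∀ {σ} → I m σ → f m ∶ σ ▹ I (suc m)
      step m m<R {σ} (sh , done) = weaken next (block m (R ∸ suc m) (m∸n+n≡m m<R) sh)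
        where
        next : ∀ {τ} → Run (f m) σ τ → Slot τ 0 (new (R ∸ suc m)) → I (suc m) τ
        next {τ} r new₀ = (λ {i b} → shifts-trans {ρ = ρ} {σ} {τ} sh sh′ {i} {b}) , done′
          where
          sh′ : Shifts B σ τ
          sh′ = subst (λ l → Shifts l σ τ) (length-f m) (run-shifts r)

          done′ : ∀ i j → j + suc m ≡ R + i → i < suc m → Slot τ i (new j)
          done′ zero    j eq _ = subst (λ j → Slot τ 0 (new j))
            (+-cancelʳ-≡ (suc m) _ j (trans (m∸n+n≡m m<R) (trans (sym (+-identityʳ R)) (sym eq)))) new₀
          done′ (suc i) j eq (s≤s i<m) = strided-shift (new j) sh′ (sym (+-assoc B (i * B) 1))
            (done i j (suc-injective (trans (sym (+-suc j m)) (trans eq (+-suc R i)))) i<m)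

  stage₁ : ℕ → Code
  stage₁ r⁻ = concat (applyUpTo (λ m → evalBlock (m * B + (r⁻ ∸ m) * n)) (suc r⁻))

  -- Slot 0 of the previous level holds vₜ and lies at `m * B + 1` once `m` blocks are laid. The
  -- block for slot `j = R - 1 - m` also reads the old slot `j + 1`, which then lies at
  -- `(m + j + 1) * B + 1`, that is, always at `R * B + 1`.
  level : ℕ → ℕ → Code
  level R t = concat (applyUpTo (λ m → selectBlock t (m * B + 1) (R * B + 1)) R)

  generate : ℕ → Code
  generate r⁻ = stage₁ r⁻ ++ concat (applyUpTo (λ t → level (r⁻ ∸ t) t) r⁻)

  -- The invariant is that slot `j` of level `t` holds Cₜ applied to the word of index `j + t`. Slot
  -- 0 is therefore the pivot that the next level needs, and the last level consists of it alone.
  run-generate : ∀ r⁻ (a : ℕ → Word n) {ρ} → r⁻ < n → (∀ j → j ≤ r⁻ → Strided 1 ρ (j * n) (a j)) →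
                 generate r⁻ ∶ ρ ▹ λ σ → Slot σ 0 (pivot (eval C) a r⁻)
  run-generate r⁻ a {ρ} r⁻<n at-a =
    slots (λ m → evalBlock (m * B + (r⁻ ∸ m) * n)) (suc r⁻) (λ j → eval C (a j)) (λ m → length-evalBlock (m * B + (r⁻ ∸ m) * n))
      (λ m j eq sh → run-evalBlock (m * B + (r⁻ ∸ m) * n) (a j) (strided-shift (a j) sh (cong (λ j → m * B + j * n) (index m j eq)) (at-a j (bound m j eq))))
    then λ _ start → weaken (λ _ final → final 0 ≤-refl)
      (iterated (λ t → level (r⁻ ∸ t) t) r⁻ I step λ j j≤r → subst (λ i → Slot _ j (eval C (a i))) (sym (+-identityʳ j)) (start j (s≤s (subst (_≤ r⁻) (+-identityʳ j) j≤r))))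
    where
    index : ∀ m j → j + suc m ≡ suc r⁻ → j ≡ r⁻ ∸ m
    index m j eq = trans (sym (m+n∸n≡m j m)) (cong (_∸ m) (suc-injective (trans (sym (+-suc j m)) eq)))

    bound : ∀ m j → j + suc m ≡ suc r⁻ → j ≤ r⁻
    bound m j eq = ≤-trans (m≤m+n j m) (≤-reflexive (suc-injective (trans (sym (+-suc j m)) eq)))

    I : ℕ → List Bool → Set
    I t σ = ∀ j → j + t ≤ r⁻ → Slot σ j (reduce (eval C) a t (a (j + t)))

    step : ∀ t → t < r⁻ → ∀ {σ} → I t σ → level (r⁻ ∸ t) t ∶ σ ▹ I (suc t)
    step t t<r {σ} old = weaken (λ _ done j j+t≤r → done j (m+n≤o⇒m≤o∸n (suc j) (subst (_≤ r⁻) (+-suc j t) j+t≤r)))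
      (slots (λ m → selectBlock t (m * B + 1) (R * B + 1)) R new (λ m → length-selectBlock t (m * B + 1) (R * B + 1) t<n)
        λ m j eq sh → run-selectBlock t (reduce (eval C) a t (a t)) (reduce (eval C) a t (a (j + suc t))) (m * B + 1) (R * B + 1) t<n
          (strided-shift _ sh refl (old 0 (<⇒≤ t<r)))
          (strided-shift _ sh (slot-index j m B eq) (subst (λ i → Slot σ (suc j) (reduce (eval C) a t (a i))) (sym (+-suc j t)) (old (suc j) (fits m j eq)))))
      where
      R = r⁻ ∸ t

      t<n : t < n
      t<n = <-trans t<r r⁻<n

      new : ℕ → Word n
      new j = reduce (eval C) a (suc t) (a (j + suc t))

      fits : ∀ m j → j + suc m ≡ R → suc j + t ≤ r⁻
      fits m j eq = m≤o∸n⇒m+n≤o (suc j) (<⇒≤ t<r) (≤-trans (subst (suc j ≤_) (sym (+-suc j m)) (s≤s (m≤m+n j m))) (≤-reflexive eq))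

-- Tracing a word backwards

infix 8 _‼_

_‼_ : ∀ {n} → Word n → ℕ → Bool
[]      ‼ i     = false
(x ∷ w) ‼ zero  = x
(x ∷ w) ‼ suc i = w ‼ i

-- Both words built in the backward trace have this shape: the starting word has the prescribed bit
-- followed by 0, and the word that `select` moves to vₜ has 0 followed by 1.
splice : ∀ {n} → ℕ → Bool → Bool → Word n → Word n
splice t       b d []      = []
splice zero    b d (x ∷ w) = b ∷ Vec.replicate _ d
splice (suc t) b d (x ∷ w) = x ∷ splice t b d w

splice-below : ∀ {n} t b d (w : Word n) {i} → i < t → splice t b d w ‼ i ≡ w ‼ i
splice-below t       b d []      i<t       = refl
splice-below (suc t) b d (x ∷ w) {zero}  i<t = refl
splice-below (suc t) b d (x ∷ w) {suc i} i<t = splice-below t b d w (s≤s⁻¹ i<t)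

splice-at : ∀ {n} t b d (w : Word n) → t < n → splice t b d w ‼ t ≡ b
splice-at zero    b d (x ∷ w) t<n       = refl
splice-at (suc t) b d (x ∷ w) (s≤s t<n) = splice-at t b d w t<n

allFrom-replicate : ∀ n → allFrom 0 (Vec.replicate n true) ≡ true
allFrom-replicate zero    = refl
allFrom-replicate (suc n) = allFrom-replicate n

allFrom-splice-true : ∀ {n} t b (w : Word n) → allFrom (suc t) (splice t b true w) ≡ true
allFrom-splice-true t       b []      = refl
allFrom-splice-true {suc n} zero b (x ∷ w) = allFrom-replicate n
allFrom-splice-true (suc t) b (x ∷ w) = allFrom-splice-true t b w

-- The bound guarantees a bit above position `t`, which is then 0. This is where `k ≤ n - 2` enters.
allFrom-splice-false : ∀ {n} t b (w : Word n) → suc t < n → allFrom (suc t) (splice t b false w) ≡ false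
allFrom-splice-false zero    b (x ∷ y ∷ w) _         = refl
allFrom-splice-false zero    b (x ∷ [])    (s≤s ())
allFrom-splice-false (suc t) b (x ∷ w)     (s≤s t<n) = allFrom-splice-false t b w t<n

allFrom-splice-mid : ∀ {n} t d (w : Word n) → t < n → allFrom t (splice t false d w) ≡ false
allFrom-splice-mid zero    d (x ∷ w) _         = refl
allFrom-splice-mid (suc t) d (x ∷ w) (s≤s t<n) = allFrom-splice-mid t d w t<n

allFrom-pred : ∀ {n} t (w : Word n) → allFrom (suc t) w ≡ false → allFrom t w ≡ false
allFrom-pred zero    (x ∷ w) eq = trans (cong (x ∧_) eq) (∧-zeroʳ x)
allFrom-pred (suc t) (x ∷ w) eq = allFrom-pred t w eq

agree : Bool → Bool → Bool
agree b c = if b then c else (if c then false else true)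

same : ∀ {n} → Word n → Word n → Bool
same []      []      = true
same (x ∷ v) (y ∷ w) = agree x y ∧ same v w

same-sound : ∀ {n} (v w : Word n) → same v w ≡ true → v ≡ w
same-sound []          []          eq = refl
same-sound (true  ∷ v) (true  ∷ w) eq = cong (true ∷_) (same-sound v w eq)
same-sound (false ∷ v) (false ∷ w) eq = cong (false ∷_) (same-sound v w eq)

same-refl : ∀ {n} (w : Word n) → same w w ≡ true
same-refl []          = refl
same-refl (true  ∷ w) = same-refl w
same-refl (false ∷ w) = same-refl w

undo : ∀ {n} → ℕ → Word n → Word n → Word n
-- In the first case `e` equals `v`, so splicing `v` keeps the bits of `e`. As the replacement is
-- then independent of `e`, the program for `g` can build it from vₜ alone.
undo t v e = if same e v then splice t false true v else e

backtrack : ∀ {n} → (ℕ → Word n) → Word n → ℕ → ℕ → Word n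
backtrack v z t zero    = z
backtrack v z t (suc m) = undo t (v t) (backtrack v z (suc t) m)

escapee : ∀ {n} → (ℕ → Word n) → ℕ → Bool → Word n
escapee v k b = backtrack v (splice k b false (v k)) 0 (suc k)

module _ {n : ℕ} (c : Word n → Word n) (a : ℕ → Word n) (k : ℕ) (b : Bool) (k<n : suc k < n)
         (consistent : ∀ t j → t < k → t < j → j ≤ k → reduce c a (suc t) (a j) ‼ t ≡ pivot c a (suc t) ‼ t) where
  private
    v = pivot c a
    z = splice k b false (v k)

    -- Bit `s` is settled at level `s + 1` by consistency. A later selection returns either the old
    -- word or the pivot of that level, and by induction both already carry the settled bit.
    prefix : ∀ u t → u ≤ t → t ≤ k → ∀ s → s < u → reduce c a u (a t) ‼ s ≡ v (suc s) ‼ s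
    prefix (suc u) t u<t t≤k s s<1+u with m≤n⇒m<n∨m≡n (s≤s⁻¹ s<1+u)
    ... | inj₂ refl = consistent s t (≤-trans u<t t≤k) u<t t≤k
    ... | inj₁ s<u with allFrom (suc u) (reduce c a u (a t))
    ...   | true  = prefix u u ≤-refl (≤-trans (<⇒≤ u<t) t≤k) s s<u
    ...   | false = prefix u t (<⇒≤ u<t) t≤k s s<u

    true≢false : true ≢ false
    true≢false ()

    -- Bit `k` is prescribed rather than taken from a pivot, so the second clause stops below `k`;
    -- the third speaks about the start `t = suc k`.
    Good : ℕ → Word n → Set
    Good t e = allFrom t e ≡ false × (∀ s → s < t → s < k → e ‼ s ≡ v (suc s) ‼ s) × (k < t → e ‼ k ≡ b)

    start : Good (suc k) z
    start = allFrom-splice-false k b (v k) k<n ,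
      (λ s _ s<k → trans (splice-below k b false (v k) s<k) (prefix k k ≤-refl ≤-refl s s<k)) ,
      λ _ → splice-at k b false (v k) (<⇒≤ k<n)

    -- If `e` differs from vₜ, being live at `t + 1` makes it a fixed point of `select`. If `e` is
    -- vₜ, its replacement has only 1 above `t`: `select` sends it to vₜ, and it is not vₜ, which is
    -- live at `t + 1`.
    undo-good : ∀ t e → t ≤ k → Good (suc t) e →
                Good t (undo t (v t) e) × undo t (v t) e ≢ v t × select t (v t) (undo t (v t) e) ≡ e
    undo-good t e t≤k (live , below , _) with same e (v t) in eq
    ... | false = (allFrom-pred t e live , (λ s s<t → below s (m≤n⇒m≤1+n s<t)) , λ k<t → ⊥-elim (<⇒≱ k<t t≤k)) ,
                  (λ e≡v → true≢false (trans (sym (trans (cong (λ w → same w (v t)) e≡v) (same-refl (v t)))) eq)) ,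
                  cong (λ q → if q then v t else e) live
    ... | true with refl ← same-sound e (v t) eq =
      (allFrom-splice-mid t true (v t) (≤-trans (s≤s t≤k) (<⇒≤ k<n)) ,
       (λ s s<t s<k → trans (splice-below t false true (v t) s<t) (below s (m≤n⇒m≤1+n s<t) s<k)) ,
       λ k<t → ⊥-elim (<⇒≱ k<t t≤k)) ,
      (λ e≡v → true≢false (trans (sym (allFrom-splice-true t false (v t))) (trans (cong (allFrom (suc t)) e≡v) live))) ,
      cong (λ q → if q then v t else splice t false true (v t)) (allFrom-splice-true t false (v t))

    -- The clauses yield, in this order, that `x` differs from aₛ, that it agrees with the earlier
    -- words on Pₛ, and that Pₖ takes the prescribed value on it.
    Follows : ℕ → Word n → Set
    Follows t x = ∀ s → t ≤ s → s ≤ k →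
      reduce c a s x ≢ v s × (s < k → reduce c a (suc s) x ‼ s ≡ v (suc s) ‼ s) × (s ≡ k → reduce c a (suc s) x ‼ s ≡ b)

    follow : ∀ m t → t + m ≡ suc k → Good t (backtrack v z t m) ×
             (∀ x → reduce c a t x ≡ backtrack v z t m → Follows t x)
    follow zero    t eq with refl ← trans (sym (+-identityʳ t)) eq =
      start , λ _ _ s k<s s≤k → ⊥-elim (<⇒≱ k<s s≤k)
    follow (suc m) t eq = good′ , follows
      where
      eq′ : suc t + m ≡ suc k
      eq′ = trans (sym (+-suc t m)) eq

      e′ = backtrack v z (suc t) m
      e  = undo t (v t) e′
      IH = follow m (suc t) eq′

      undone : Good t e × e ≢ v t × select t (v t) e ≡ e′
      undone = undo-good t e′ (s≤s⁻¹ (≤-trans (m≤m+n (suc t) m) (≤-reflexive eq′))) (proj₁ IH)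

      good′ = proj₁ undone

      follows : ∀ x → reduce c a t x ≡ e → Follows t x
      follows x x≡ s t≤s s≤k with m≤n⇒m<n∨m≡n t≤s
      ... | inj₁ t<s  = proj₂ IH x (trans (cong (select t (v t)) x≡) (proj₂ (proj₂ undone))) s t<s s≤k
      ... | inj₂ refl = (λ x≡v → proj₁ (proj₂ undone) (trans (sym x≡) x≡v)) ,
                        (λ s<k → trans (cong (_‼ s) x≡′) (proj₁ (proj₂ (proj₁ IH)) s ≤-refl s<k)) ,
                        λ { refl → trans (cong (_‼ s) x≡′) (proj₂ (proj₂ (proj₁ IH)) ≤-refl) }
        where
        x≡′ : reduce c a (suc s) x ≡ e′
        x≡′ = trans (cong (select t (v t)) x≡) (proj₂ (proj₂ undone))

  escapee-live : allFrom 0 (escapee v k b) ≡ false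
  escapee-live = proj₁ (proj₁ (follow (suc k) 0 refl))

  escapee-follows : ∀ x → c x ≡ escapee v k b → ∀ s → s ≤ k →
    reduce c a s x ≢ v s × (s < k → reduce c a (suc s) x ‼ s ≡ v (suc s) ‼ s) × (s ≡ k → reduce c a (suc s) x ‼ s ≡ b)
  escapee-follows x x≡ s = proj₂ (follow (suc k) 0 refl) x x≡ s z≤n

-- The reduction

wireIndex : ∀ {ρ k b m} → length ρ ≡ m → ρ [ k ]↦ b → Fin m
wireIndex refl here      = Fin.zero
wireIndex refl (there p) = Fin.suc (wireIndex refl p)

toℕ-wireIndex : ∀ {ρ k b m} (eq : length ρ ≡ m) (p : ρ [ k ]↦ b) → toℕ (wireIndex eq p) ≡ k
toℕ-wireIndex refl here      = refl
toℕ-wireIndex refl (there p) = cong suc (toℕ-wireIndex refl p)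

gate : ∀ {ρ g b m} → length ρ ≡ m → ρ ⊢ g ⇒ b → Gate m
gate {g = const b} eq const     = const b
gate               eq (neg p)   = neg (wireIndex eq p)
gate               eq (and p q) = and (wireIndex eq p) (wireIndex eq q)
gate               eq (or p q)  = or (wireIndex eq p) (wireIndex eq q)

instruction-gate : ∀ {ρ g b m} (eq : length ρ ≡ m) (d : ρ ⊢ g ⇒ b) → instruction (gate eq d) ≡ g
instruction-gate eq const     = refl
instruction-gate eq (neg p)   = cong neg (toℕ-wireIndex eq p)
instruction-gate eq (and p q) = cong₂ and (toℕ-wireIndex eq p) (toℕ-wireIndex eq q)
instruction-gate eq (or p q)  = cong₂ or (toℕ-wireIndex eq p) (toℕ-wireIndex eq q)

-- The wire values of the run leave no trace in the gates, so a run on a single input yields a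
-- circuit for all inputs.
circuit : ∀ {gs ρ σ m} → length ρ ≡ m → Run gs ρ σ → Gates m (length σ)
circuit refl []       = []
circuit refl (d ∷ ds) = gate refl d ∷ circuit refl ds

code-circuit : ∀ {gs ρ σ m} (eq : length ρ ≡ m) (r : Run gs ρ σ) → code (circuit eq r) ≡ gs
code-circuit refl []       = refl
code-circuit refl (d ∷ ds) = cong₂ _∷_ (instruction-gate refl d) (code-circuit refl ds)

strided-‼ : ∀ {s n ρ d} (w : Word n) → Strided s ρ d w → ∀ {i} → i < n → ρ [ i * s + d ]↦ w ‼ i
strided-‼ (x ∷ w) (p , ps) {zero}  _         = p
strided-‼ {s} {d = d} (x ∷ w) (p , ps) {suc i} (s≤s i<n) = at (lemma i s d) (strided-‼ w ps i<n)
  where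
  lemma : ∀ i s d → i * s + (s + d) ≡ s + i * s + d
  lemma = solve-∀

word : ∀ {n r} → Vec (Word n) r → ℕ → Word n
word []       j       = Vec.replicate _ false
word (x ∷ xs) zero    = x
word (x ∷ xs) (suc j) = word xs j

strided-toList : ∀ {n} (x : Word n) {σ} → Strided 1 (toList x ++ σ) 0 x
strided-toList []      = _
strided-toList (b ∷ x) = here , strided-shift x there refl (strided-toList x)

strided-words : ∀ {n r} (xs : Vec (Word n) r) j → j < r → Strided 1 (toList (Vec.concat xs)) (j * n) (word xs j)
strided-words {n} (x ∷ xs) j j<r = subst (λ ρ → Strided 1 ρ (j * n) (word (x ∷ xs) j)) (sym (toList-++ x (Vec.concat xs))) (go j j<r)
  where
  go : ∀ j → j < _ → Strided 1 (toList x ++ toList (Vec.concat xs)) (j * n) (word (x ∷ xs) j)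
  go zero    _         = strided-toList x
  go (suc j) (s≤s j<r) = strided-shift (word xs j) (++-↦ (toList x)) (cong (_+ j * n) (length-toList x)) (strided-words xs j j<r)

word-lookup : ∀ {n r} (xs : Vec (Word n) r) i → lookup xs i ≡ word xs (toℕ i)
word-lookup (x ∷ xs) Fin.zero    = refl
word-lookup (x ∷ xs) (Fin.suc i) = word-lookup xs i

word-∷ʳ : ∀ {n r} (xs : Vec (Word n) r) x {j} → j < r → word (xs ∷ʳ x) j ≡ word xs j
word-∷ʳ (y ∷ xs) x {zero}  _         = refl
word-∷ʳ (y ∷ xs) x {suc j} (s≤s j<r) = word-∷ʳ xs x j<r

word-last : ∀ {n r} (xs : Vec (Word n) r) x → word (xs ∷ʳ x) r ≡ x
word-last []       x = refl
word-last (y ∷ xs) x = word-last xs x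

word-truncate : ∀ {n m r} (m≤r : m ≤ r) (xs : Vec (Word n) r) {j} → j < m → word (truncate m≤r xs) j ≡ word xs j
word-truncate (s≤s m≤r) (x ∷ xs) {zero}  _         = refl
word-truncate (s≤s m≤r) (x ∷ xs) {suc j} (s≤s j<m) = word-truncate m≤r xs j<m

reduce-cong : ∀ {n} (c : Word n → Word n) {a b : ℕ → Word n} t → (∀ {j} → j < t → a j ≡ b j) → ∀ x → reduce c a t x ≡ reduce c b t x
reduce-cong c zero    a≗b x = refl
reduce-cong c {a} {b} (suc t) a≗b x = cong₂ (select t)
  (trans (cong (reduce c a t) (a≗b ≤-refl)) (reduce-cong c t (λ j<t → a≗b (m≤n⇒m≤1+n j<t)) (b t)))
  (reduce-cong c t (λ j<t → a≗b (m≤n⇒m≤1+n j<t)) x)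

singleOutput : ∀ {m gs ρ σ i b} → length ρ ≡ m → Run gs ρ σ → σ [ i ]↦ b → Circuit m 1
singleOutput eq r p = record { gates = circuit eq r ; outputs = wireIndex refl p ∷ [] }

head-singleOutput : ∀ {m gs ρ σ i b} (eq : length ρ ≡ m) (r : Run gs ρ σ) (p : σ [ i ]↦ b) →
                    ∀ (xs : Vec Bool m) {τ c} → Run gs (toList xs) τ → τ [ i ]↦ c →
                    Vec.head (eval (singleOutput eq r p) xs) ≡ c
head-singleOutput {gs = gs} {i = i} eq r p xs {τ} {c} r′ p′ = ↦-functional
  (at (toℕ-wireIndex refl p) (subst (_[ toℕ o ]↦ lookup ρ o) (++-identityʳ (toList ρ)) (lookup-↦ ρ o)))
  (subst (_[ i ]↦ c) (run-functional r′ run″) p′)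
  where
  o = wireIndex refl p
  ρ = evalGates (circuit eq r) xs

  run″ : Run gs (toList xs) (toList ρ)
  run″ = subst (λ hs → Run hs (toList xs) (toList ρ)) (code-circuit eq r)
    (subst₂ (Run (code (circuit eq r))) (++-identityʳ (toList xs)) (++-identityʳ (toList ρ)) (run-code (circuit eq r) xs))

-- `predicate-code` and `predicate-output` determine the encoded circuit, which the program for `f`
-- has to print; `predicate-eval` is its meaning.
record Realisation {n r : ℕ} (gs : Code) (i : ℕ) (F : Vec (Word n) r → Bool) : Set where
  field
    predicate        : Circuit (r * n) 1
    predicate-code   : code (gates predicate) ≡ gs
    predicate-output : Vec.map toℕ (outputs predicate) ≡ i ∷ []
    predicate-eval   : ∀ ys → Vec.head (eval predicate (Vec.concat ys)) ≡ F ys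

-- The run on the all-false input supplies the bounds on the indices. On any other input, evaluation
-- runs the same code, and runs are deterministic, so it agrees with the run that `spec` provides
-- there.
realise : ∀ {n r} gs i (F : Vec (Word n) r → Bool) → (∀ ys → gs ∶ toList (Vec.concat ys) ▹ (_[ i ]↦ F ys)) →
          Realisation gs i F
realise {n} {r} gs i F spec with σ , run , p ← spec (Vec.replicate r (Vec.replicate n false)) = record
  { predicate        = singleOutput len run p
  ; predicate-code   = code-circuit len run
  ; predicate-output = cong (_∷ []) (toℕ-wireIndex refl p)
  ; predicate-eval   = λ ys → let _ , run′ , p′ = spec ys in head-singleOutput len run p (Vec.concat ys) run′ p′
  }
  where
  len = length-toList (Vec.concat (Vec.replicate r (Vec.replicate n false)))

value<2^ : ∀ {n} (w : Word n) → value w < 2 ^ n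
value<2^ []          = s≤s z≤n
value<2^ {suc n} (false ∷ w) = *-monoʳ-< 2 (value<2^ w)
value<2^ {suc n} (true ∷ w)  = ≤-trans (≤-reflexive (lemma (value w))) (*-monoʳ-≤ 2 (value<2^ w))
  where
  lemma : ∀ v → suc (suc (2 * v)) ≡ 2 * suc v
  lemma = solve-∀

value-live : ∀ {n} (w : Word n) → allFrom 0 w ≡ false → value w < 2 ^ n ∸ 1
value-live {n} w live = m+n≤o⇒m≤o∸n (suc (value w)) (subst (_≤ 2 ^ n) (+-comm 1 (suc (value w))) (go w live))
  where
  lemma : ∀ v → 3 + 2 * v ≤ 2 * (2 + v)
  lemma v = ≤-trans (n≤1+n _) (≤-reflexive (lemma′ v))
    where
    lemma′ : ∀ v → 4 + 2 * v ≡ 2 * (2 + v)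
    lemma′ = solve-∀

  lemma₂ : ∀ v → 2 + 2 * v ≡ 2 * suc v
  lemma₂ = solve-∀

  go : ∀ {n} (w : Word n) → allFrom 0 w ≡ false → 2 + value w ≤ 2 ^ n
  go {suc n} (false ∷ w) _    = ≤-trans (≤-reflexive (lemma₂ (value w))) (*-monoʳ-≤ 2 (value<2^ w))
  go {suc n} (true  ∷ w) live = ≤-trans (lemma (value w)) (*-monoʳ-≤ 2 (go w live))

all-∷ʳ : ∀ {A : Set} {P : A → Set} {r} {xs : Vec A r} {x} → All P xs → P x → All P (xs ∷ʳ x)
all-∷ʳ []         q = q ∷ []
all-∷ʳ (p ∷ ps) q = p ∷ all-∷ʳ ps q

unique-∷ʳ : ∀ {A : Set} {r} {xs : Vec A r} {x} → Unique xs → x ∉ xs → Unique (xs ∷ʳ x)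
unique-∷ʳ []       x∉xs = [] ∷ []
unique-∷ʳ (p ∷ ps) x∉xs = all-∷ʳ p (λ y≡x → x∉xs (here (sym y≡x))) ∷ unique-∷ʳ ps (λ x∈xs → x∉xs (there x∈xs))

∈⇒word : ∀ {n r} {xs : Vec (Word n) r} {x} → x ∈ xs → ∃ λ j → j < r × x ≡ word xs j
∈⇒word (here refl) = 0 , s≤s z≤n , refl
∈⇒word (there p)   = let j , j<r , eq = ∈⇒word p in suc j , s≤s j<r , eq

-- Correctness of the reduction

module Reduce {n : ℕ} (2≤n : 2 ≤ n) (C : Circuit n n) where

  1≤n : 1 ≤ n
  1≤n = <⇒≤ 2≤n

  open Generator n 1≤n C

  <n⁻⇒<n : ∀ {i} → i < n ∸ 1 → suc i < n
  <n⁻⇒<n i<n⁻ = subst (_ <_) (sym n≡) (s≤s i<n⁻)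

  run-words : ∀ r⁻ {r} (ys : Vec (Word n) r) → r⁻ < r → r⁻ < n →
              generate r⁻ ∶ toList (Vec.concat ys) ▹ λ σ → Slot σ 0 (pivot (eval C) (word ys) r⁻)
  run-words r⁻ ys r⁻<r r⁻<n = run-generate r⁻ (word ys) r⁻<n λ j j≤r⁻ → strided-words ys j (≤-trans (s≤s j≤r⁻) r⁻<r)

  abstract
    realisation : ∀ (i : Fin (n ∸ 1)) → Realisation {n} {2 + toℕ i} (generate (suc (toℕ i))) (toℕ i * 5 + 1)
                    (λ ys → pivot (eval C) (word ys) (suc (toℕ i)) ‼ toℕ i)
    realisation i = realise _ _ _ λ ys → weaken (λ _ slot → strided-‼ _ slot (<⇒≤ (<n⁻⇒<n (toℕ<n i))))
      (run-words (suc (toℕ i)) ys ≤-refl (<n⁻⇒<n (toℕ<n i)))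

  module _ (i : Fin (n ∸ 1)) where
    open Realisation (realisation i) public

  -- Appended to `as`, the word `x` has index `i + 1`, and its image under Cᵢ₊₁ is the pivot of that
  -- level. So one generator serves both the predicates and the pivots that `g` needs.
  holds≡ : ∀ i as x → holds predicate i as x ≡ reduce (eval C) (word as) (suc (toℕ i)) x ‼ toℕ i
  holds≡ i as x = trans (predicate-eval i (as ∷ʳ x)) (cong (_‼ toℕ i)
    (trans (cong (reduce (eval C) (word (as ∷ʳ x)) (suc (toℕ i))) (word-last as x))
           (reduce-cong (eval C) (suc (toℕ i)) (word-∷ʳ as x) x)))

  holds-truncate : ∀ i {r} (le : suc (toℕ i) ≤ r) (as : Vec (Word n) r) x →
                   holds predicate i (truncate le as) x ≡ reduce (eval C) (word as) (suc (toℕ i)) x ‼ toℕ i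
  holds-truncate i le as x = trans (holds≡ i (truncate le as) x)
    (cong (_‼ toℕ i) (reduce-cong (eval C) (suc (toℕ i)) (word-truncate le as) x))

  -- The summands count at most `n + 1` evaluation blocks, and at most `n` levels of at most `n`
  -- selection blocks.
  length-generate : ∀ r⁻ → r⁻ ≤ n → length (generate r⁻) ≤ suc n * B + n * (n * B)
  length-generate r⁻ r⁻≤n = ≤-trans (≤-reflexive (length-++ (stage₁ r⁻))) (+-mono-≤
    (≤-trans (length-iterated (λ m → evalBlock (m * B + (r⁻ ∸ m) * n)) (suc r⁻) (λ m _ → ≤-reflexive (length-evalBlock (m * B + (r⁻ ∸ m) * n))))
      (*-monoˡ-≤ B (s≤s r⁻≤n)))
    (≤-trans (length-iterated (λ t → level (r⁻ ∸ t) t) r⁻ {n * B} (λ t t<r → ≤-trans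
        (length-iterated (λ m → selectBlock t (m * B + 1) ((r⁻ ∸ t) * B + 1)) (r⁻ ∸ t) (λ m _ → ≤-reflexive (length-selectBlock t (m * B + 1) ((r⁻ ∸ t) * B + 1) (≤-trans t<r r⁻≤n))))
        (*-monoˡ-≤ B (≤-trans (m∸n≤m r⁻ t) r⁻≤n))))
      (*-monoˡ-≤ (n * B) r⁻≤n)))

  module _ (k : Fin (n ∸ 1)) (a : Vec (Word n) (suc (toℕ k))) (b : Bool) (sub : Subcertificate predicate a) where
    private
      c = eval C
      K = toℕ k

    open Subcertificate sub

    -- The reference value in a subcertificate is taken at the word of index `t + 1`, whose image
    -- under Cₜ₊₁ is by definition the pivot of level `t + 1`.
    consistent′ : ∀ t j → t < K → t < j → j ≤ K →
                  reduce c (word a) (suc t) (word a j) ‼ t ≡ pivot c (word a) (suc t) ‼ t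
    consistent′ t j t<K t<j j≤K =
      subst₂ (λ t j → reduce c (word a) (suc t) (word a j) ‼ t ≡ pivot c (word a) (suc t) ‼ t) i≡ j≡
        (trans (sym (step (lookup a j′) (word-lookup a j′)))
          (trans (consistent i i<K j′ (subst₂ _<_ (sym i≡) (sym j≡) t<j))
            (step _ (trans (word-lookup a (fromℕ< (s≤s i<K))) (cong (word a) (toℕ-fromℕ< (s≤s i<K)))))))
      where
      t<n⁻ = <-trans t<K (toℕ<n k)
      i = fromℕ< t<n⁻
      i≡ : toℕ i ≡ t
      i≡ = toℕ-fromℕ< t<n⁻
      j′ = fromℕ< (s≤s j≤K)
      j≡ : toℕ j′ ≡ j
      j≡ = toℕ-fromℕ< (s≤s j≤K)
      i<K = subst (_< K) (sym i≡) t<K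

      step : ∀ x {y} → x ≡ y → holds predicate i (truncate (s≤s (<⇒≤ i<K)) a) x ≡ reduce c (word a) (suc (toℕ i)) y ‼ toℕ i
      step x refl = holds-truncate i (s≤s (<⇒≤ i<K)) a x

    solution : Word n
    solution = escapee (pivot c (word a)) K b

    solution-live : solution ∈[ 2 ^ n ∸ 1 ]
    solution-live = value-live solution (escapee-live c (word a) K b (<n⁻⇒<n (toℕ<n k)) consistent′)

    solution-empty : ¬ (∃ λ x → _Extends_ predicate x a × holds predicate k a x ≡ b) →
                     ∀ x → x ∈[ 2 ^ n ∸ 2 ] → c x ≢ solution
    solution-empty noExtension x x∈U cx≡ = noExtension (x , record
      { inU            = x∈U
      ; fresh          = fresh
      ; subcertificate = record
        { inU        = all-∷ʳ inU x∈U
        ; distinct   = unique-∷ʳ distinct fresh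
        ; consistent = λ i i<k j i<j → trans
            (step i (s≤s (<⇒≤ i<k)) (lookup (a ∷ʳ x) j) (word-lookup (a ∷ʳ x) j))
            (trans (agreement (toℕ i) (toℕ j) (s≤s⁻¹ i<k) i<j (s≤s⁻¹ (toℕ<n j)))
              (sym (step i (s≤s (<⇒≤ i<k)) _ (trans (word-lookup (a ∷ʳ x) (fromℕ< (s≤s i<k)))
                                                     (cong (word (a ∷ʳ x)) (toℕ-fromℕ< (s≤s i<k)))))))
        }
      } , trans (holds≡ k a x) (proj₂ (proj₂ (follows K ≤-refl)) refl))
      where
      follows = escapee-follows c (word a) K b (<n⁻⇒<n (toℕ<n k)) consistent′ x cx≡

      fresh : x ∉ a
      fresh x∈a = let j , j<r , x≡ = ∈⇒word x∈a in
        proj₁ (follows j (s≤s⁻¹ j<r)) (cong (reduce c (word a) j) x≡)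

      step : ∀ i (le : suc (toℕ i) ≤ suc (suc K)) y {z} → y ≡ z →
             holds predicate i (truncate le (a ∷ʳ x)) y ≡ reduce c (word (a ∷ʳ x)) (suc (toℕ i)) z ‼ toℕ i
      step i le y refl = holds-truncate i le (a ∷ʳ x) y

      settled : ∀ i j → i < K → i < j → j ≤ suc K →
                reduce c (word (a ∷ʳ x)) (suc i) (word (a ∷ʳ x) j) ‼ i ≡ pivot c (word a) (suc i) ‼ i
      settled i j i<K i<j j≤1+K = trans
        (cong (_‼ i) (reduce-cong c (suc i) (λ j<1+i → word-∷ʳ a x (<-trans j<1+i (s≤s i<K))) (word (a ∷ʳ x) j)))
        (last (m≤n⇒m<n∨m≡n j≤1+K))
        where
        last : j < suc K ⊎ j ≡ suc K → reduce c (word a) (suc i) (word (a ∷ʳ x) j) ‼ i ≡ pivot c (word a) (suc i) ‼ i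
        last (inj₁ j<1+K) = trans (cong (λ y → reduce c (word a) (suc i) y ‼ i) (word-∷ʳ a x j<1+K))
          (consistent′ i j i<K i<j (s≤s⁻¹ j<1+K))
        last (inj₂ refl)  = trans (cong (λ y → reduce c (word a) (suc i) y ‼ i) (word-last a x))
          (proj₁ (proj₂ (follows i (<⇒≤ i<K))) i<K)

      agreement : ∀ i j → i ≤ K → i < j → j ≤ suc K →
                  reduce c (word (a ∷ʳ x)) (suc i) (word (a ∷ʳ x) j) ‼ i ≡
                  reduce c (word (a ∷ʳ x)) (suc i) (word (a ∷ʳ x) (suc i)) ‼ i
      agreement i j i≤K i<j j≤1+K with m≤n⇒m<n∨m≡n i≤K
      ... | inj₁ i<K  = trans (settled i j i<K i<j j≤1+K) (sym (settled i (suc i) i<K ≤-refl (s≤s i≤K)))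
      -- For `i = K` the only later index is `suc K`, so the two sides are the same value.
      ... | inj₂ refl = cong (λ j → reduce c (word (a ∷ʳ x)) (suc i) (word (a ∷ʳ x) j) ‼ i) (≤-antisym j≤1+K i<j)

module _ (p : Polynomial) where

  sizeBound : ℕ → ℕ
  sizeBound n = suc n * suc (⟦ p ⟧ n + n * 10) + n * (n * suc (⟦ p ⟧ n + n * 10))

  sizeBoundᴾ : IsPolynomial sizeBound
  sizeBoundᴾ = (constᴾ 1 +ᴾ idᴾ) *ᴾ blockᴾ +ᴾ idᴾ *ᴾ (idᴾ *ᴾ blockᴾ)
    where
    blockᴾ = constᴾ 1 +ᴾ (⟦ p ⟧ᴾ +ᴾ idᴾ *ᴾ constᴾ 10)

  sizePolynomial : Polynomial
  sizePolynomial = proj₁ sizeBoundᴾ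

  module _ (I : EmptyInstance p) where
    open EmptyInstance I
    open Reduce 2≤n C

    toShortChoice : ShortChoiceInstance sizePolynomial
    toShortChoice = record
      { n      = n
      ; 2≤n    = 2≤n
      ; P      = predicate
      ; P-size = λ i → begin
          circuitSize (predicate i)              ≡⟨ length-code (gates (predicate i)) ⟨
          length (code (gates (predicate i)))    ≡⟨ cong length (predicate-code i) ⟩
          length (Generator.generate n 1≤n C (suc (toℕ i)))  ≤⟨ length-generate (suc (toℕ i)) (<⇒≤ (<n⁻⇒<n (toℕ<n i))) ⟩
          suc n * suc (s + n * 10) + n * (n * suc (s + n * 10))
            ≤⟨ +-mono-≤ (*-monoʳ-≤ (suc n) B≤) (*-monoʳ-≤ n (*-monoʳ-≤ n B≤)) ⟩
          sizeBound n                            ≡⟨ proj₂ sizeBoundᴾ n ⟨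
          ⟦ sizePolynomial ⟧ n                   ∎
      }
      where
      open ≤-Reasoning
      s = length (code (gates C))
      B≤ : suc (s + n * 10) ≤ suc (⟦ p ⟧ n + n * 10)
      B≤ = s≤s (+-monoˡ-≤ (n * 10) (≤-trans (≤-reflexive (length-code (gates C))) C-size))

    fromShortChoice : ShortChoiceSolution sizePolynomial toShortChoice → EmptySolution p I
    fromShortChoice S = record
      { e     = solution k a c subcertificate
      ; e∈    = solution-live k a c subcertificate
      ; empty = solution-empty k a c subcertificate noExtension
      }
      where open ShortChoiceSolution S

-- Programs computing encoded functions

-- The tree function is constrained only on encodings of elements of `Γ`, which may carry proofs
-- that are not encoded. A loop variable extends `Γ` to `Γ × ℕ`; `↑` is weakening and `↓` the newest
-- variable.
record Computes {Γ X : Set} (enc : Γ → Tree) (encX : X → Tree) (φ : Γ → X) : Set where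
  constructor computes
  field
    {function} : Tree → Tree
    efficient  : Poly function
    correct    : ∀ γ → function (enc γ) ≡ encX (φ γ)

infixr 4 _⊠_

_⊠_ : {Γ X : Set} → (Γ → Tree) → (X → Tree) → Γ × X → Tree
(enc ⊠ encX) (γ , x) = enc γ ∙ encX x

↑ : ∀ {Γ X Y : Set} {enc : Γ → Tree} {encX : X → Tree} {encY : Y → Tree} {φ : Γ → Y} →
    Computes enc encY φ → Computes (enc ⊠ encX) encY (φ ∘ proj₁)
↑ (computes π ok) = computes (π ∘P leftP) λ (γ , x) → ok γ

↓ : ∀ {Γ X : Set} {enc : Γ → Tree} {encX : X → Tree} → Computes (enc ⊠ encX) encX proj₂
↓ = computes rightP λ _ → refl

-- Interpretation of code on trees

encodeInstruction : Instruction → Tree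
encodeInstruction (const b) = encodeℕ 0 ∙ encodeBool b
encodeInstruction (neg i)   = encodeℕ 1 ∙ encodeℕ i
encodeInstruction (and i j) = encodeℕ 2 ∙ encodeℕ i ∙ encodeℕ j
encodeInstruction (or i j)  = encodeℕ 3 ∙ encodeℕ i ∙ encodeℕ j

encodeCode : Code → Tree
encodeCode = encodeList encodeInstruction

encodeBits : List Bool → Tree
encodeBits = encodeList encodeBool

mulT-code : ∀ k gs → mulT (encodeℕ k) (encodeCode gs) ≡ encodeCode (times k gs)
mulT-code zero    gs = refl
mulT-code (suc k) gs = trans (cong (appendT (encodeCode gs)) (mulT-code k gs))
  (appendT-encodeList encodeInstruction gs (times k gs))

-- Missing bits read as false, which is what left nil encodes.
bitAt : List Bool → ℕ → Bool
bitAt []      k       = false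
bitAt (b ∷ ρ) zero    = b
bitAt (b ∷ ρ) (suc k) = bitAt ρ k

lookupT-bits : ∀ ρ k → lookupT (encodeBits ρ) (encodeℕ k) ≡ encodeBool (bitAt ρ k)
lookupT-bits []      k       = cong left (dropT-nil (encodeℕ k))
lookupT-bits (b ∷ ρ) zero    = refl
lookupT-bits (b ∷ ρ) (suc k) = lookupT-bits ρ k

executeInstruction : Instruction → List Bool → Bool
executeInstruction (const b) ρ = b
executeInstruction (neg i)   ρ = not (bitAt ρ i)
executeInstruction (and i j) ρ = bitAt ρ i ∧ bitAt ρ j
executeInstruction (or i j)  ρ = bitAt ρ i ∨ bitAt ρ j

execute : Code → List Bool → List Bool
execute []       ρ = ρ
execute (g ∷ gs) ρ = execute gs (executeInstruction g ρ ∷ ρ)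

↦⇒bitAt : ∀ {ρ k b} → ρ [ k ]↦ b → bitAt ρ k ≡ b
↦⇒bitAt here      = refl
↦⇒bitAt (there p) = ↦⇒bitAt p

run⇒execute : ∀ {gs ρ σ} → Run gs ρ σ → execute gs ρ ≡ σ
run⇒execute []               = refl
run⇒execute (const ∷ ds)     = run⇒execute ds
run⇒execute (neg p ∷ ds)   rewrite ↦⇒bitAt p = run⇒execute ds
run⇒execute (and p q ∷ ds) rewrite ↦⇒bitAt p | ↦⇒bitAt q = run⇒execute ds
run⇒execute (or p q ∷ ds)  rewrite ↦⇒bitAt p | ↦⇒bitAt q = run⇒execute ds

trueT : Tree
trueT = nil ∙ nil

-- The tag is a unary number from 0 to 3, so testing it and its successive tails separates `const`,
-- `neg`, `and` and `or`.
instructionT : Tree → Tree → Tree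
instructionT s h =
  ifT (left h)
    (ifT (right (left h))
      (ifT (right (right (left h)))
        (ifT (lookupT s (2nd h)) trueT (lookupT s (3rd⁺ h)))
        (ifT (lookupT s (2nd h)) (lookupT s (3rd⁺ h)) nil))
      (ifT (lookupT s (right h)) nil trueT))
    (right h)

instructionT-correct : ∀ g ρ → instructionT (encodeBits ρ) (encodeInstruction g) ≡ encodeBool (executeInstruction g ρ)
instructionT-correct (const b) ρ = refl
instructionT-correct (neg i) ρ rewrite lookupT-bits ρ i with bitAt ρ i
... | true  = refl
... | false = refl
instructionT-correct (and i j) ρ rewrite lookupT-bits ρ i | lookupT-bits ρ j with bitAt ρ i
... | true  = refl
... | false = refl
instructionT-correct (or i j) ρ rewrite lookupT-bits ρ i | lookupT-bits ρ j with bitAt ρ i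
... | true  = refl
... | false = refl

-- The new bit is normalised so that a step adds a bounded number of nodes.
executeStep : Tree → Tree
executeStep x = ifT (instructionT (2nd x) (3rd x)) trueT nil ∙ 2nd x

executeStepP : Poly executeStep
executeStepP =
  ifP (ifP (leftP ∘P h)
        (ifP (rightP ∘P leftP ∘P h)
          (ifP (rightP ∘P rightP ∘P leftP ∘P h)
            (ifP (lookupP s (2ndP ∘P h)) (constP trueT) (lookupP s (3rd⁺P ∘P h)))
            (ifP (lookupP s (2ndP ∘P h)) (lookupP s (3rd⁺P ∘P h)) (constP nil)))
          (ifP (lookupP s (rightP ∘P h)) (constP nil) (constP trueT)))
        (rightP ∘P h))
      (constP trueT) (constP nil) ∙P s
  where
  s = 2ndP
  h = 3rdP

executeT : Tree → Tree → Tree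
executeT gs ρ = foldlT executeStep nil ρ gs

executeP : ∀ {G R} → Poly G → Poly R → Poly (λ x → executeT (G x) (R x))
executeP γ ρ = foldlᴾ executeStepP
  ((λ _ → 4) , constᴾ 4 , λ e s h t → ≤-trans (s≤s (+-monoˡ-≤ (size s) (bit≤3 (instructionT s h)))) (≤-reflexive (+-comm 4 (size s))))
  (constP nil) ρ γ
  where
  bit≤3 : ∀ x → size (ifT x trueT nil) ≤ 3
  bit≤3 nil     = s≤s z≤n
  bit≤3 (_ ∙ _) = ≤-refl

executeT-correct : ∀ gs ρ → executeT (encodeCode gs) (encodeBits ρ) ≡ encodeBits (execute gs ρ)
executeT-correct []       ρ = refl
executeT-correct (g ∷ gs) ρ = trans
  (cong (λ b → executeT (encodeCode gs) (b ∙ encodeBits ρ))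
    (trans (cong (λ b → ifT b trueT nil) (instructionT-correct g ρ)) (normal (executeInstruction g ρ))))
  (executeT-correct gs (executeInstruction g ρ ∷ ρ))
  where
  normal : ∀ b → ifT (encodeBool b) trueT nil ≡ encodeBool b
  normal true  = refl
  normal false = refl

ifPositive : {X : Set} → ℕ → X → X → X
ifPositive zero    x y = y
ifPositive (suc _) x y = x

allT-bits : ∀ bs → allT (encodeBits bs) ≡ encodeBool (ListAction.and bs)
allT-bits []           = refl
allT-bits (true  ∷ bs) = allT-bits bs
allT-bits (false ∷ bs) = refl

module _ {Γ : Set} {enc : Γ → Tree} where

  litC : ∀ k → Computes enc encodeℕ (λ _ → k)
  litC k = computes (constP (encodeℕ k)) λ _ → refl

  boolC : ∀ b → Computes enc encodeBool (λ _ → b)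
  boolC b = computes (constP (encodeBool b)) λ _ → refl

  infixl 6 _+C_ _∸C_
  infixl 7 _*C_
  infixr 5 _++C_

  sucC : ∀ {f : Γ → ℕ} → Computes enc encodeℕ f → Computes enc encodeℕ (λ γ → suc (f γ))
  sucC (computes π ok) = computes (constP nil ∙P π) λ γ → cong (nil ∙_) (ok γ)

  _+C_ : ∀ {f g : Γ → ℕ} → Computes enc encodeℕ f → Computes enc encodeℕ g → Computes enc encodeℕ (λ γ → f γ + g γ)
  _+C_ {f} {g} (computes π ok) (computes π′ ok′) = computes (appendP π π′) λ γ →
    trans (cong₂ appendT (ok γ) (ok′ γ)) (appendT-ℕ (f γ) (g γ))

  _*C_ : ∀ {f g : Γ → ℕ} → Computes enc encodeℕ f → Computes enc encodeℕ g → Computes enc encodeℕ (λ γ → f γ * g γ)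
  _*C_ {f} {g} (computes π ok) (computes π′ ok′) = computes (mulP π π′) λ γ →
    trans (cong₂ mulT (ok γ) (ok′ γ)) (mulT-ℕ (f γ) (g γ))

  _∸C_ : ∀ {f g : Γ → ℕ} → Computes enc encodeℕ f → Computes enc encodeℕ g → Computes enc encodeℕ (λ γ → f γ ∸ g γ)
  _∸C_ {f} {g} (computes π ok) (computes π′ ok′) = computes (dropP π′ π) λ γ →
    trans (cong₂ dropT (ok′ γ) (ok γ)) (dropT-ℕ (g γ) (f γ))

  constC : Computes enc encodeCode (λ _ → const true ∷ [])
  constC = computes (constP _) λ _ → refl

  negC : ∀ {f : Γ → ℕ} → Computes enc encodeℕ f → Computes enc encodeCode (λ γ → neg (f γ) ∷ [])
  negC (computes π ok) = computes ((constP _ ∙P π) ∙P constP nil) λ γ → cong (λ i → (encodeℕ 1 ∙ i) ∙ nil) (ok γ)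

  andC : ∀ {f g : Γ → ℕ} → Computes enc encodeℕ f → Computes enc encodeℕ g → Computes enc encodeCode (λ γ → and (f γ) (g γ) ∷ [])
  andC (computes π ok) (computes π′ ok′) = computes ((constP _ ∙P π ∙P π′) ∙P constP nil) λ γ →
    cong₂ (λ i j → (encodeℕ 2 ∙ i ∙ j) ∙ nil) (ok γ) (ok′ γ)

  orC : ∀ {f g : Γ → ℕ} → Computes enc encodeℕ f → Computes enc encodeℕ g → Computes enc encodeCode (λ γ → or (f γ) (g γ) ∷ [])
  orC (computes π ok) (computes π′ ok′) = computes ((constP _ ∙P π ∙P π′) ∙P constP nil) λ γ →
    cong₂ (λ i j → (encodeℕ 3 ∙ i ∙ j) ∙ nil) (ok γ) (ok′ γ)

  _++C_ : ∀ {f g : Γ → Code} → Computes enc encodeCode f → Computes enc encodeCode g → Computes enc encodeCode (λ γ → f γ ++ g γ)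
  _++C_ {f} {g} (computes π ok) (computes π′ ok′) = computes (appendP π π′) λ γ →
    trans (cong₂ appendT (ok γ) (ok′ γ)) (appendT-encodeList encodeInstruction (f γ) (g γ))

  timesC : ∀ {f : Γ → ℕ} {g : Γ → Code} → Computes enc encodeℕ f → Computes enc encodeCode g →
           Computes enc encodeCode (λ γ → times (f γ) (g γ))
  timesC {f} {g} (computes π ok) (computes π′ ok′) = computes (mulP π π′) λ γ →
    trans (cong₂ mulT (ok γ) (ok′ γ)) (mulT-code (f γ) (g γ))

  lengthC : ∀ {f : Γ → Code} → Computes enc encodeCode f → Computes enc encodeℕ (λ γ → length (f γ))
  lengthC {f} (computes π ok) = computes (mapP (constP nil) (constP nil) π) λ γ → trans (cong (mapT (λ _ → nil) nil) (ok γ)) (units (f γ))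
    where
    units : ∀ gs → mapT (λ _ → nil) nil (encodeCode gs) ≡ encodeℕ (length gs)
    units []       = refl
    units (g ∷ gs) = cong (nil ∙_) (units gs)

  tabulateC : ∀ {X : Set} {encX : X → Tree} {f : Γ → ℕ} {φ : Γ × ℕ → X} →
              Computes enc encodeℕ f → Computes (enc ⊠ encodeℕ) encX φ →
              Computes enc (encodeList encX) (λ γ → applyUpTo (λ i → φ (γ , i)) (f γ))
  tabulateC {f = f} (computes π ok) (computes {F} π′ ok′) = computes
    (mapP π′ idP (rangeP π)) λ γ →
      trans (cong (λ k → mapT F (enc γ) (rangeT k)) (ok γ)) (mapT-range {F = F} {enc γ} (λ i → ok′ (γ , i)) (f γ))

  concatC : ∀ {X : Set} {encX : X → Tree} {φ : Γ → List (List X)} →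
            Computes enc (encodeList (encodeList encX)) φ → Computes enc (encodeList encX) (λ γ → List.concat (φ γ))
  concatC {encX = encX} {φ} (computes π ok) = computes (concatP π) λ γ → trans (cong concatT (ok γ)) (concatT-encodeList encX (φ γ))

  forC : ∀ {f : Γ → ℕ} {φ : Γ × ℕ → Code} → Computes enc encodeℕ f → Computes (enc ⊠ encodeℕ) encodeCode φ →
         Computes enc encodeCode (λ γ → List.concat (applyUpTo (λ i → φ (γ , i)) (f γ)))
  forC κ body = concatC (tabulateC κ body)

  executeC : ∀ {f : Γ → Code} {ρ : Γ → List Bool} → Computes enc encodeCode f → Computes enc encodeBits ρ →
             Computes enc encodeBits (λ γ → execute (f γ) (ρ γ))
  executeC {f} {ρ} (computes π ok) (computes π′ ok′) = computes (executeP π π′) λ γ →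
    trans (cong₂ executeT (ok γ) (ok′ γ)) (executeT-correct (f γ) (ρ γ))

  bitAtC : ∀ {ρ : Γ → List Bool} {f : Γ → ℕ} → Computes enc encodeBits ρ → Computes enc encodeℕ f →
           Computes enc encodeBool (λ γ → bitAt (ρ γ) (f γ))
  bitAtC {ρ} {f} (computes π ok) (computes π′ ok′) = computes (lookupP π π′) λ γ →
    trans (cong₂ lookupT (ok γ) (ok′ γ)) (lookupT-bits (ρ γ) (f γ))

  ifC : ∀ {X : Set} {encX : X → Tree} {b : Γ → Bool} {f g : Γ → X} → Computes enc encodeBool b →
        Computes enc encX f → Computes enc encX g → Computes enc encX (λ γ → if b γ then f γ else g γ)
  ifC {encX = encX} {b} {f} {g} (computes β ok) (computes π ok′) (computes π′ ok″) = computes (ifP β π π′) λ γ →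
    trans (cong₂ (λ c x → ifT c x _) (ok γ) (ok′ γ)) (trans (cong (ifT (encodeBool (b γ)) (encX (f γ))) (ok″ γ)) (branch (b γ)))
    where
    branch : ∀ b {x y} → ifT (encodeBool b) (encX x) (encX y) ≡ encX (if b then x else y)
    branch true  = refl
    branch false = refl

  ifPositiveC : ∀ {X : Set} {encX : X → Tree} {k : Γ → ℕ} {f g : Γ → X} → Computes enc encodeℕ k →
                Computes enc encX f → Computes enc encX g → Computes enc encX (λ γ → ifPositive (k γ) (f γ) (g γ))
  ifPositiveC {encX = encX} {k} {f} {g} (computes β ok) (computes π ok′) (computes π′ ok″) = computes (ifP β π π′) λ γ →
    trans (cong₂ (λ c x → ifT c x _) (ok γ) (ok′ γ)) (trans (cong (ifT (encodeℕ (k γ)) (encX (f γ))) (ok″ γ)) (branch (k γ)))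
    where
    branch : ∀ k {x y} → ifT (encodeℕ k) (encX x) (encX y) ≡ encX (ifPositive k x y)
    branch zero    = refl
    branch (suc k) = refl

  conjunctionC : ∀ {φ : Γ → List Bool} → Computes enc encodeBits φ → Computes enc encodeBool (λ γ → ListAction.and (φ γ))
  conjunctionC {φ} (computes π ok) = computes (allP π) λ γ → trans (cong allT (ok γ)) (allT-bits (φ γ))

-- This is the recursion of `backtrack`. Only `test` sees the current value; `new` does not, so a
-- step either keeps the state or installs a tree of size bounded independently of it, as `foldrP`
-- requires.
overwrite : ∀ {Γ X : Set} → (((Γ × ℕ) × X) → Bool) → (Γ × ℕ → X) → Γ → X → ℕ → ℕ → X
overwrite test new γ x t zero    = x
overwrite test new γ x t (suc m) =
  let y = overwrite test new γ x (suc t) m in if test ((γ , t) , y) then new (γ , t) else y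

overwriteC : ∀ {Γ X : Set} {enc : Γ → Tree} {encX : X → Tree} {k : Γ → ℕ} {start : Γ → X} {test new} →
             Computes enc encodeℕ k → Computes enc encX start →
             Computes ((enc ⊠ encodeℕ) ⊠ encX) encodeBool test → Computes (enc ⊠ encodeℕ) encX new →
             Computes enc encX (λ γ → overwrite test new γ (start γ) 0 (k γ))
overwriteC {enc = enc} {encX} {k} {start} {test} {new} (computes κ okκ) (computes {S} σ okσ) (computes {T} τ okτ) (computes {N} ν okν) = computes
  (foldrP (ifP (τ ∘P ((leftP ∙P 2ndP) ∙P 3rd⁺P)) (ν ∘P (leftP ∙P 2ndP)) 3rd⁺P)
    (_ , isPoly ν , λ e h s → branch (T ((e ∙ h) ∙ s)) (N (e ∙ h)) s (size-Poly ν (e ∙ h)))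
    idP σ (rangeP κ))
  λ γ → trans (cong₂ (λ s n → foldrT step (enc γ) s (rangeT n)) (okσ γ) (okκ γ))
          (trans (cong (foldrT step (enc γ) (encX (start γ))) (rangeT-ℕ (k γ))) (unfold γ (start γ) 0 (k γ) id λ i → refl))
  where
  step : Tree → Tree
  step x = ifT (T ((left x ∙ 2nd x) ∙ 3rd⁺ x)) (N (left x ∙ 2nd x)) (3rd⁺ x)

  branch : ∀ b x s {m} → size x ≤ m → size (ifT b x s) ≤ size s + m
  branch nil     x s x≤m = m≤m+n _ _
  branch (_ ∙ _) x s x≤m = ≤-trans x≤m (m≤n+m _ _)

  choose : ∀ b {x y} → ifT (encodeBool b) (encX x) (encX y) ≡ encX (if b then x else y)
  choose true  = refl
  choose false = refl

  unfold : ∀ γ x t m f → (∀ i → f i ≡ t + i) →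
         foldrT step (enc γ) (encX x) (encodeList encodeℕ (applyUpTo f m)) ≡ encX (overwrite test new γ x t m)
  unfold γ x t zero    f f≡ = refl
  unfold γ x t (suc m) f f≡
    rewrite unfold γ x (suc t) m (f ∘ suc) (λ i → trans (f≡ (suc i)) (+-suc t i))
          | trans (f≡ 0) (+-identityʳ t)
          | okτ ((γ , t) , overwrite test new γ x (suc t) m) | okν (γ , t) =
    choose (test ((γ , t) , overwrite test new γ x (suc t) m))

-- The programs of the reduction

infixr 9 _∘C_

_∘C_ : ∀ {Γ X Y : Set} {enc : Γ → Tree} {encX : X → Tree} {encY : Y → Tree} {φ : Γ → X} {ψ : X → Y} →
       Computes encX encY ψ → Computes enc encX φ → Computes enc encY (ψ ∘ φ)
_∘C_ {φ = φ} (computes {F} π ok) (computes π′ ok′) = computes (π ∘P π′) λ γ → trans (cong F (ok′ γ)) (ok (φ γ))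

idC : ∀ {Γ : Set} {enc : Γ → Tree} → Computes enc enc id
idC = computes idP λ _ → refl

pairC : ∀ {Γ X Y : Set} {enc : Γ → Tree} {encX : X → Tree} {encY : Y → Tree} {φ : Γ → X} {ψ : Γ → Y} →
        Computes enc encX φ → Computes enc encY ψ → Computes enc (encX ⊠ encY) (λ γ → φ γ , ψ γ)
pairC (computes π ok) (computes π′ ok′) = computes (π ∙P π′) λ γ → cong₂ _∙_ (ok γ) (ok′ γ)

treeC : ∀ {Γ X : Set} {enc : Γ → Tree} {encX : X → Tree} {φ : Γ → X} →
        Computes enc encX φ → Computes enc id (encX ∘ φ)
treeC (computes π ok) = computes π ok

infixr 5 _∙C_

_∙C_ : ∀ {Γ : Set} {enc : Γ → Tree} {φ ψ : Γ → Tree} →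
       Computes enc id φ → Computes enc id ψ → Computes enc id (λ γ → φ γ ∙ ψ γ)
computes π ok ∙C computes π′ ok′ = computes (π ∙P π′) λ γ → cong₂ _∙_ (ok γ) (ok′ γ)

computes⇒polyTime : ∀ {Γ X : Set} {enc output : Γ → Tree} {encX : X → Tree} {φ : Γ → X} →
                    Computes enc encX φ → (∀ γ → encX (φ γ) ≡ output γ) → PolyTime enc output
computes⇒polyTime (computes π ok) φ≡ = polyTime π λ γ → trans (ok γ) (φ≡ γ)

encodeInstruction-gate : ∀ {w} (g : Gate w) → encodeGate g ≡ encodeInstruction (instruction g)
encodeInstruction-gate (const b) = refl
encodeInstruction-gate (neg i)   = refl
encodeInstruction-gate (and i j) = refl
encodeInstruction-gate (or i j)  = refl

encodeCode-gates : ∀ {m w} (gs : Gates m w) → encodeGates gs ≡ encodeCode (code gs)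
encodeCode-gates []       = refl
encodeCode-gates (g ∷ gs) = cong₂ _∙_ (encodeInstruction-gate g) (encodeCode-gates gs)

-- A nonempty suffix of an output list, split into head and tail as `revMapTails` presents it; the
-- offset of `outputUnit` is read off the length of the tail.
Outputs : Set
Outputs = Σ ℕ λ w → Σ ℕ λ n → Fin w × Vec (Fin w) n

encodeOutputs : Outputs → Tree
encodeOutputs (_ , _ , o , os) = encodeFin o ∙ encodeVec encodeFin os

outputUnitC : Computes encodeOutputs encodeCode (λ (_ , n , o , _) → outputUnit (n * 5 + toℕ o))
outputUnitC = constC ++C constC ++C constC ++C orC i i ++C constC
  where
  units : ∀ {w n} (os : Vec (Fin w) n) → mapT (λ _ → nil) nil (encodeVec encodeFin os) ≡ encodeℕ n
  units []       = refl
  units (_ ∷ os) = cong (nil ∙_) (units os)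

  i : Computes encodeOutputs encodeℕ (λ (_ , n , o , _) → 3 + (n * 5 + toℕ o))
  i = litC 3 +C (computes (mapP (constP nil) (constP nil) rightP) (λ (_ , _ , _ , os) → units os) *C litC 5 +C
                 computes leftP λ _ → refl)

module _ (p : Polynomial) where
  open EmptyInstance
  open SearchProblem (Empty p)

  nC : Computes encodeInstance encodeℕ n
  nC = computes leftP λ _ → refl

  codeC : Computes encodeInstance encodeCode (λ I → code (gates (C I)))
  codeC = computes 2ndP λ I → encodeCode-gates (gates (C I))

  -- `outputCode` starts with the last output, which is the order in which `revMapTails`
  -- accumulates.
  outputCodeC : Computes encodeInstance encodeCode (λ I → outputCode (outputs (C I)))
  outputCodeC = computes (concatP (revMapTailsP (efficient ∘P rightP) (constP nil) (constP nil) 3rd⁺P))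
    λ I → trans (onto (outputs (C I)) []) (cong encodeCode (++-identityʳ _))
    where
    open Computes outputUnitC

    onto : ∀ {w n} (os : Vec (Fin w) n) (acc : List Code) →
           concatT (revMapTails (λ x → function (right x)) nil (encodeList encodeCode acc) (encodeVec encodeFin os)) ≡
           encodeCode (outputCode os ++ List.concat acc)
    onto []       acc = concatT-encodeList encodeInstruction acc
    onto {n = suc n} (o ∷ os) acc = trans
      (cong (λ u → concatT (revMapTails (λ x → function (right x)) nil (u ∙ encodeList encodeCode acc) (encodeVec encodeFin os)))
            (correct (_ , n , o , os)))
      (trans (onto os (outputUnit (n * 5 + toℕ o) ∷ acc))
             (cong encodeCode (sym (++-assoc (outputCode os) (outputUnit (n * 5 + toℕ o)) (List.concat acc)))))

  module Gen (I : EmptyInstance p) = Generator (n I) (Reduce.1≤n (2≤n I) (C I)) (C I)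

  module _ {Γ : Set} {enc : Γ → Tree} {ι : Γ → EmptyInstance p} (I : Computes enc encodeInstance ι) where
    private
      N = nC ∘C I
      S = lengthC (codeC ∘C I)

    blockC : Computes enc encodeℕ (λ γ → Gen.B (ι γ))
    blockC = sucC (S +C N *C litC 10)

    evalBlockC : ∀ {d} → Computes enc encodeℕ d → Computes enc encodeCode (λ γ → Gen.evalBlock (ι γ) (d γ))
    evalBlockC D = timesC (N *C litC 4 +C litC 1) constC ++C timesC N (orC K K) ++C (codeC ∘C I) ++C (outputCodeC ∘C I)
      where
      K = D +C (N *C litC 4 +C litC 1) +C (N ∸C litC 1)

    selectBlockC : ∀ {t d e} → Computes enc encodeℕ t → Computes enc encodeℕ d → Computes enc encodeℕ e →
                   Computes enc encodeCode (λ γ → Gen.selectBlock (ι γ) (t γ) (d γ) (e γ))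
    selectBlockC T D E =
      timesC (S +C litC 1) constC ++C
      timesC (N ∸C sucC T) (andC (E +C (S +C litC 1) +C (N ∸C litC 1) *C litC 5) (litC 0) ++C copy 4) ++C
      timesC (sucC T *C litC 5) (orC (litC 0) (litC 0)) ++C
      timesC N (andC (litC 0) (muxAt D) ++C negC (litC 1) ++C andC (litC 0) (litC 2 +C muxAt E) ++C
                orC (litC 0) (litC 2) ++C orC (litC 4) (litC 4))
      where
      copy : ∀ k → Computes enc encodeCode (λ _ → times k (or 0 0 ∷ []))
      copy k = timesC (litC k) (orC (litC 0) (litC 0))
      muxAt : ∀ {d} → Computes enc encodeℕ d → Computes enc encodeℕ (λ γ → Gen.muxAt (ι γ) (d γ))
      muxAt D = D +C (S +C litC 1 +C N *C litC 5) +C (N ∸C litC 1) *C litC 5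

  levelC : Computes ((encodeInstance ⊠ encodeℕ) ⊠ encodeℕ) encodeCode (λ ((I , R) , t) → Gen.level I R t)
  levelC = forC (↑ ↓) (selectBlockC (↑ (↑ (↑ idC))) (↑ ↓) (↓ *C B +C litC 1) (↑ (↑ ↓) *C B +C litC 1))
    where
    B = blockC (↑ (↑ (↑ idC)))

  generateC : Computes (encodeInstance ⊠ encodeℕ) encodeCode (λ (I , r⁻) → Gen.generate I r⁻)
  generateC = forC (sucC ↓) (evalBlockC (↑ (↑ idC)) (↓ *C blockC (↑ (↑ idC)) +C (↑ ↓ ∸C ↓) *C (nC ∘C ↑ (↑ idC)))) ++C
              forC ↓ (levelC ∘C (pairC (pairC (↑ (↑ idC)) (↑ ↓ ∸C ↓)) ↓))

-- The backward trace on lists of bits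

rawSplice : ℕ → ℕ → Bool → Bool → List Bool → List Bool
-- Truncated subtraction serves as comparison: `t ∸ j` is positive for `j` below `t`, and `j ∸ t`
-- for `j` above `t`.
rawSplice n t b d w = applyUpTo (λ j → ifPositive (t ∸ j) (bitAt w j) (ifPositive (j ∸ t) d b)) n

rawSplice-toList : ∀ {n} t b d (w : Word n) → rawSplice n t b d (toList w) ≡ toList (splice t b d w)
rawSplice-toList         t       b d []      = refl
rawSplice-toList {suc n} zero    b d (x ∷ w) = cong (b ∷_) (constant n)
  where
  constant : ∀ n → applyUpTo (λ _ → d) n ≡ toList (Vec.replicate n d)
  constant zero    = refl
  constant (suc n) = cong (d ∷_) (constant n)
rawSplice-toList         (suc t) b d (x ∷ w) = cong (x ∷_) (rawSplice-toList t b d w)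

rawSame : ℕ → List Bool → List Bool → Bool
rawSame n v w = ListAction.and (applyUpTo (λ j → agree (bitAt v j) (bitAt w j)) n)

rawSame-toList : ∀ {n} (v w : Word n) → rawSame n (toList v) (toList w) ≡ same v w
rawSame-toList []      []      = refl
rawSame-toList (x ∷ v) (y ∷ w) = cong (agree x y ∧_) (rawSame-toList v w)

readSlot : ℕ → List Bool → List Bool
readSlot n ρ = applyUpTo (λ j → bitAt ρ (j * 5 + 1)) n

readSlot-strided : ∀ {n ρ} (w : Word n) → Strided 5 ρ 1 w → readSlot n ρ ≡ toList w
readSlot-strided {ρ = ρ} w at-w = go w (λ j → j * 5 + 1) (λ j → refl) at-w
  where
  lemma : ∀ j d → suc j * 5 + d ≡ j * 5 + (5 + d)
  lemma = solve-∀

  go : ∀ {n d} (w : Word n) f → (∀ j → f j ≡ j * 5 + d) → Strided 5 ρ d w → applyUpTo (bitAt ρ ∘ f) n ≡ toList w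
  go []      f f≡ _             = refl
  go {d = d} (x ∷ w) f f≡ (at-x , at-w) =
    cong₂ _∷_ (trans (cong (bitAt ρ) (f≡ 0)) (↦⇒bitAt at-x))
              (go w (f ∘ suc) (λ j → trans (f≡ (suc j)) (lemma j d)) at-w)

encodeWord-toList : ∀ {n} (w : Word n) → encodeWord w ≡ encodeBits (toList w)
encodeWord-toList []      = refl
encodeWord-toList (x ∷ w) = cong (encodeBool x ∙_) (encodeWord-toList w)

concatT-words : ∀ {n r} (a : Vec (Word n) r) → concatT (encodeVec encodeWord a) ≡ encodeBits (toList (Vec.concat a))
concatT-words []      = refl
concatT-words (x ∷ a) = trans (cong₂ appendT (encodeWord-toList x) (concatT-words a))
  (trans (appendT-encodeList encodeBool (toList x) _) (cong encodeBits (sym (toList-++ x (Vec.concat a)))))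

module _ {Γ : Set} {enc : Γ → Tree} where

  spliceC : ∀ {n t b d w} → Computes enc encodeℕ n → Computes enc encodeℕ t → Computes enc encodeBool b →
            Computes enc encodeBool d → Computes enc encodeBits w →
            Computes enc encodeBits (λ γ → rawSplice (n γ) (t γ) (b γ) (d γ) (w γ))
  spliceC N T B D W = tabulateC N (ifPositiveC (↑ T ∸C ↓) (bitAtC (↑ W) ↓) (ifPositiveC (↓ ∸C ↑ T) (↑ D) (↑ B)))

  sameC : ∀ {n v w} → Computes enc encodeℕ n → Computes enc encodeBits v → Computes enc encodeBits w →
          Computes enc encodeBool (λ γ → rawSame (n γ) (v γ) (w γ))
  sameC N V W = conjunctionC (tabulateC N (ifC x y (ifC y (boolC false) (boolC true))))
    where
    x = bitAtC (↑ V) ↓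
    y = bitAtC (↑ W) ↓

module _ (p : Polynomial) where
  open SearchProblem

  encodeVec-outputs : ∀ {w m i} (os : Vec (Fin w) m) → Vec.map toℕ os ≡ i → encodeVec encodeFin os ≡ encodeVec encodeℕ i
  encodeVec-outputs []       refl = refl
  encodeVec-outputs (o ∷ os) refl = cong (encodeFin o ∙_) (encodeVec-outputs os refl)

  encodeVec-tabulate : ∀ m (g : Fin m → Tree) (h : ℕ → Tree) → (∀ i → g i ≡ h (toℕ i)) →
                       encodeList id (applyUpTo h m) ≡ encodeVec id (Vec.tabulate g)
  encodeVec-tabulate zero    g h g≡h = refl
  encodeVec-tabulate (suc m) g h g≡h = cong₂ _∙_ (sym (g≡h Fin.zero)) (encodeVec-tabulate m (g ∘ Fin.suc) (h ∘ suc) (g≡h ∘ Fin.suc))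

  predicateT : EmptyInstance p × ℕ → Tree
  predicateT (I , i) = encodeCode (Gen.generate p I (suc i)) ∙ encodeℕ (i * 5 + 1) ∙ nil

  predicateC : Computes (encodeInstance (Empty p) ⊠ encodeℕ) id predicateT
  predicateC = treeC (generateC p ∘C pairC (↑ idC) (sucC ↓)) ∙C treeC (↓ *C litC 5 +C litC 1) ∙C treeC (litC 0)

  toShortChoice-polyTime : PolyTime (encodeInstance (Empty p)) (λ I → encodeInstance (ShortChoice (sizePolynomial p)) (toShortChoice p I))
  toShortChoice-polyTime = computes⇒polyTime (treeC (nC p) ∙C treeC (tabulateC (nC p ∸C litC 1) predicateC))
    λ I → cong (encodeℕ (EmptyInstance.n I) ∙_) (encodeVec-tabulate _ _ (λ i → predicateT (I , i)) (encodePredicate I))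
    where
    encodePredicate : ∀ I i → encodeCircuit (ShortChoiceInstance.P (toShortChoice p I) i) ≡ predicateT (I , toℕ i)
    encodePredicate I i = cong₂ _∙_
      (trans (encodeCode-gates (gates (predicate i))) (cong encodeCode (predicate-code i)))
      (encodeVec-outputs (outputs (predicate i)) (predicate-output i))
      where
      open EmptyInstance I
      open Reduce 2≤n C

  Solved : Set
  Solved = Σ (EmptyInstance p) λ I → ShortChoiceSolution (sizePolynomial p) (toShortChoice p I)

  encodeSolved : Solved → Tree
  encodeSolved (I , s) = encodeInstance (Empty p) I ∙ encodeSolution (ShortChoice (sizePolynomial p)) {toShortChoice p I} s

  -- The code for vₜ is generated and interpreted on the words of the certificate, afresh for each
  -- `t`, which avoids the doubling recursion of `reduce`.
  rawPivot : Solved → ℕ → List Bool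
  rawPivot (I , S) t = readSlot n (execute (Gen.generate p I t) (toList (Vec.concat a)))
    where
    open EmptyInstance I
    open ShortChoiceSolution S

  rawPivot-toList : ∀ (γ@(I , S) : Solved) t → t ≤ toℕ (ShortChoiceSolution.k S) →
                    rawPivot γ t ≡ toList (pivot (eval (EmptyInstance.C I)) (word (ShortChoiceSolution.a S)) t)
  rawPivot-toList (I , S) t t≤k = trans (cong (readSlot n) (run⇒execute (proj₁ (proj₂ ran)))) (readSlot-strided _ (proj₂ (proj₂ ran)))
    where
    open EmptyInstance I
    open ShortChoiceSolution S
    open Reduce 2≤n C
    ran = run-words t a (s≤s t≤k) (≤-trans (s≤s t≤k) (<⇒≤ (<n⁻⇒<n (toℕ<n k))))

  test : (Solved × ℕ) × List Bool → Bool
  test ((γ@(I , _) , t) , e) = rawSame (EmptyInstance.n I) e (rawPivot γ t)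

  new : Solved × ℕ → List Bool
  new (γ@(I , _) , t) = rawSplice (EmptyInstance.n I) t false true (rawPivot γ t)

  rawSolution : Solved → List Bool
  rawSolution γ@(I , S) = overwrite test new γ (rawSplice n (toℕ k) c false (rawPivot γ (toℕ k))) 0 (suc (toℕ k))
    where
    open EmptyInstance I
    open ShortChoiceSolution S

  rawSolution-correct : ∀ (γ@(I , S) : Solved) → rawSolution γ ≡ toList (EmptySolution.e (fromShortChoice p I S))
  rawSolution-correct γ@(I , S) = go (suc (toℕ k)) 0 refl
    where
    open EmptyInstance I
    open ShortChoiceSolution S
    v = pivot (eval C) (word a)
    z = splice (toℕ k) c false (v (toℕ k))

    splices : ∀ t b d → t ≤ toℕ k → rawSplice n t b d (rawPivot γ t) ≡ toList (splice t b d (v t))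
    splices t b d t≤k = trans (cong (rawSplice n t b d) (rawPivot-toList γ t t≤k)) (rawSplice-toList t b d (v t))

    bound : ∀ m t → t + suc m ≡ suc (toℕ k) → t ≤ toℕ k
    bound m t eq = s≤s⁻¹ (≤-trans (m≤m+n (suc t) m) (≤-reflexive (trans (sym (+-suc t m)) eq)))

    go : ∀ m t → t + m ≡ suc (toℕ k) →
         overwrite test new γ (rawSplice n (toℕ k) c false (rawPivot γ (toℕ k))) t m ≡ toList (backtrack v z t m)
    go zero    t eq = splices (toℕ k) c false ≤-refl
    go (suc m) t eq = branches
      (trans (cong₂ (rawSame n) e≡ (rawPivot-toList γ t (bound m t eq))) (rawSame-toList (backtrack v z (suc t) m) (v t)))
      (splices t false true (bound m t eq)) e≡
      where
      e≡ = go m (suc t) (trans (sym (+-suc t m)) eq)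

      branches : ∀ {b b′ x x′ y} {y′ : Word n} → b ≡ b′ → x ≡ toList x′ → y ≡ toList y′ →
                 (if b then x else y) ≡ toList (if b′ then x′ else y′)
      branches {true}  refl x≡ y≡ = x≡
      branches {false} refl x≡ y≡ = y≡

  instanceC : Computes encodeSolved (encodeInstance (Empty p)) proj₁
  instanceC = computes leftP λ _ → refl

  indexC : Computes encodeSolved encodeℕ (λ (_ , S) → toℕ (ShortChoiceSolution.k S))
  indexC = computes 2ndP λ _ → refl

  bitsC : Computes encodeSolved encodeBits (λ (_ , S) → toList (Vec.concat (ShortChoiceSolution.a S)))
  bitsC = computes (concatP (leftP ∘P 3rd⁺P)) λ (_ , S) → concatT-words (ShortChoiceSolution.a S)

  choiceC : Computes encodeSolved encodeBool (λ (_ , S) → ShortChoiceSolution.c S)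
  choiceC = computes (rightP ∘P 3rd⁺P) λ _ → refl

  rawPivotC : Computes (encodeSolved ⊠ encodeℕ) encodeBits (λ (γ , t) → rawPivot γ t)
  rawPivotC = tabulateC (nC p ∘C ↑ instanceC)
    (bitAtC (↑ (executeC (generateC p ∘C pairC (↑ instanceC) ↓) (↑ bitsC))) (↓ *C litC 5 +C litC 1))

  rawSolutionC : Computes encodeSolved encodeBits rawSolution
  rawSolutionC = overwriteC (sucC indexC)
    (spliceC (nC p ∘C instanceC) indexC choiceC (boolC false) (rawPivotC ∘C pairC idC indexC))
    (sameC (nC p ∘C ↑ (↑ instanceC)) ↓ (↑ rawPivotC))
    (spliceC (nC p ∘C ↑ instanceC) ↓ (boolC false) (boolC true) rawPivotC)

  fromShortChoice-polyTime : PolyTime encodeSolved (λ (I , S) → encodeSolution (Empty p) {I} (fromShortChoice p I S))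
  fromShortChoice-polyTime = computes⇒polyTime rawSolutionC
    λ γ → trans (cong encodeBits (rawSolution-correct γ)) (sym (encodeWord-toList _))

theorem7 : PEPP-hard ShortChoice
theorem7 p = sizePolynomial p , record
  { f          = toShortChoice p
  ; g          = fromShortChoice p
  ; f-polyTime = toShortChoice-polyTime p
  ; g-polyTime = fromShortChoice-polyTime p
  }
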